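{- Let $\sigma\in\{1212,1221\}$ and let $\tau$ be a matching. Then for every $n\geq 2$, $$|\mathcal{M}_{n}(\sigma(\tau+2))|=C_{n}+\sum_{\ell=2}^{n}\sum_{k=0}^{n-\ell}\binom{2\ell-1}{\ell-2}\binom{2\ell-1+k}{k}\binom{2(n-\ell)-k}{k}\,k!\,|\mathcal{M}_{n-\ell-k}(\tau)|.$$
   Context: A matching of order $n$ is a partition of $[2n]$ into blocks (edges) of size two, identified with the word in $[n]^{2n}$ where both vertices of an edge carry the same letter and letters appear in increasing order of left vertices (so $1212=\{\{1,3\},\{2,4\}\}$, $1221=\{\{1,4\},\{2,3\}\}$). A matching $\sigma$ of order $k$ is a pattern of $\tau$ if there are $i_1<\dots<i_{2k}$ with $\{i_p,i_q\}\in\tau$ iff $\{p,q\}\in\sigma$; otherwise $\tau$ avoids $\sigma$. $\mathcal{M}_n(S)$ is the set of matchings of order $n$ avoiding all patterns in $S$ ($\mathcal{M}_0(S)$ consists of the empty matching). $\sigma(\tau+2)$ is the word of $\sigma$ followed by the word of $\tau$ with $2$ added to each letter (juxtaposition). $C_n=\frac{1}{n+1}\binom{2n}{n}$. -}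

module Defs where

open import Data.Nat as ℕ using (ℕ; zero; suc; _+_; _*_; _∸_; _/_)
open import Data.Nat.Combinatorics using (_C_)
open import Data.Nat.ListAction using (sum)
open import Data.Fin as Fin using (Fin; zero; suc; _<_; _↑ˡ_; _↑ʳ_)
import Data.Fin.Properties as Fin
open import Data.Vec as Vec using (Vec; []; _∷_; lookup; count)
open import Data.Vec.Properties using (∷-injective)
open import Data.List as List using (List; filter; length; allFin; applyUpTo; cartesianProductWith)
open import Data.List.Membership.Propositional using (_∈_; lose)
open import Data.List.Membership.Propositional.Properties using (∈-allFin; ∈-cartesianProductWith⁺; ∈-filter⁺; ∈-filter⁻)
open import Data.List.Relation.Unary.Any using (any?; here; satisfied)
open import Data.List.Relation.Unary.Unique.Propositional using (Unique)
import Data.List.Relation.Unary.Unique.Propositional.Properties as Unique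
import Data.List.Relation.Unary.All as All
import Data.List.Relation.Unary.AllPairs as AllPairs
open import Data.Product using (∃; _×_; _,_; proj₁; proj₂)
open import Function.Bundles using (_⇔_; mk⇔; Equivalence)
open import Relation.Binary.PropositionalEquality using (_≡_; _≢_; refl)
open import Relation.Nullary using (¬_; Dec)
open import Relation.Nullary.Decidable using (map′; ¬?; _×-dec_; _→-dec_)

-- Words in [n]^{2n}.  Positions and letters are numbered from 0 rather than
-- from 1.  The length is written n * 2 so that (2 + k) * 2 computes to
-- 4 + k * 2.
Word : ℕ → Set
Word n = Vec (Fin n) (n * 2)

-- Edge w i j : the pair {i , j} is a block of the partition described by w.
Edge : ∀ {n} → Word n → Fin (n * 2) → Fin (n * 2) → Set
Edge w i j = i ≢ j × lookup w i ≡ lookup w j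

LeftVertex : ∀ {n} → Word n → Fin (n * 2) → Set
LeftVertex w i = ∀ j → Edge w i j → i < j

record IsMatching {n : ℕ} (w : Word n) : Set where
  constructor isMatching
  field
    twice      : ∀ a → count (a Fin.≟_) w ≡ 2
    increasing : ∀ i j → LeftVertex w i → LeftVertex w j → i < j → lookup w i < lookup w j

IsOccurrence : ∀ {k n} → Word k → Word n → Vec (Fin (n * 2)) (k * 2) → Set
IsOccurrence σ τ i =
  (∀ p q → p < q → lookup i p < lookup i q) ×
  (∀ p q → Edge τ (lookup i p) (lookup i q) ⇔ Edge σ p q)

Contains : ∀ {k n} → Word k → Word n → Set
Contains σ τ = ∃ λ i → IsOccurrence σ τ i

Avoids : ∀ {k n} → Word k → Word n → Set
Avoids σ τ = ¬ Contains σ τ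

allVecs : ∀ n m → List (Vec (Fin n) m)
allVecs n zero    = [] List.∷ List.[]
allVecs n (suc m) = cartesianProductWith _∷_ (allFin n) (allVecs n m)

∈-allVecs : ∀ {n m} (v : Vec (Fin n) m) → v ∈ allVecs n m
∈-allVecs []      = here refl
∈-allVecs (x ∷ v) = ∈-cartesianProductWith⁺ _∷_ (∈-allFin x) (∈-allVecs v)

allVecs-unique : ∀ n m → Unique (allVecs n m)
allVecs-unique n zero    = All.[] AllPairs.∷ AllPairs.[]
allVecs-unique n (suc m) =
  Unique.cartesianProductWith⁺ _∷_ ∷-injective (Unique.allFin⁺ n) (allVecs-unique n m)

edge? : ∀ {n} (w : Word n) i j → Dec (Edge w i j)
edge? w i j = ¬? (i Fin.≟ j) ×-dec (lookup w i Fin.≟ lookup w j)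

leftVertex? : ∀ {n} (w : Word n) i → Dec (LeftVertex w i)
leftVertex? w i = Fin.all? λ j → edge? w i j →-dec (i Fin.<? j)

isMatching? : ∀ {n} (w : Word n) → Dec (IsMatching w)
isMatching? w = map′ (λ (t , i) → isMatching t i) (λ (isMatching t i) → t , i)
  ( Fin.all? (λ a → count (a Fin.≟_) w ℕ.≟ 2)
  ×-dec
    Fin.all? (λ i → Fin.all? λ j →
      leftVertex? w i →-dec (leftVertex? w j →-dec ((i Fin.<? j) →-dec (lookup w i Fin.<? lookup w j))))
  )

_⇔-dec_ : ∀ {A B : Set} → Dec A → Dec B → Dec (A ⇔ B)
a? ⇔-dec b? = map′ (λ (f , g) → mk⇔ f g) (λ e → Equivalence.to e , Equivalence.from e)
  ((a? →-dec b?) ×-dec (b? →-dec a?))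

isOccurrence? : ∀ {k n} (σ : Word k) (τ : Word n) i → Dec (IsOccurrence σ τ i)
isOccurrence? σ τ i =
  (Fin.all? λ p → Fin.all? λ q → (p Fin.<? q) →-dec (lookup i p Fin.<? lookup i q))
  ×-dec
  (Fin.all? λ p → Fin.all? λ q → edge? τ (lookup i p) (lookup i q) ⇔-dec edge? σ p q)

contains? : ∀ {k n} (σ : Word k) (τ : Word n) → Dec (Contains σ τ)
contains? {k} {n} σ τ = map′ satisfied (λ (i , occ) → lose (∈-allVecs i) occ)
  (any? (isOccurrence? σ τ) (allVecs (n * 2) (k * 2)))

-- 𝓜 n σ lists, without repetition, the matchings of order n avoiding the
-- single pattern σ (see ∈-𝓜 and 𝓜-unique), so its length is |𝓜ₙ(σ)|.
𝓜 : ∀ n {k} → Word k → List (Word n)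
𝓜 n σ = filter (λ w → isMatching? w ×-dec ¬? (contains? σ w)) (allVecs n (n * 2))

∣𝓜∣ : ∀ n {k} → Word k → ℕ
∣𝓜∣ n σ = length (𝓜 n σ)

∈-𝓜 : ∀ {n k} (σ : Word k) (w : Word n) → w ∈ 𝓜 n σ ⇔ (IsMatching w × Avoids σ w)
∈-𝓜 {n} σ w = mk⇔ (λ w∈ → proj₂ (∈-filter⁻ P? {xs = allVecs n (n * 2)} w∈)) (∈-filter⁺ P? (∈-allVecs w))
  where
  P? : (w : Word n) → Dec (IsMatching w × Avoids σ w)
  P? w = isMatching? w ×-dec ¬? (contains? σ w)

𝓜-unique : ∀ n {k} (σ : Word k) → Unique (𝓜 n σ)
𝓜-unique n σ =
  Unique.filter⁺ (λ w → isMatching? w ×-dec ¬? (contains? σ w)) (allVecs-unique n (n * 2))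

w1212 w1221 : Word 2
w1212 = zero ∷ suc zero ∷ zero ∷ suc zero ∷ []
w1221 = zero ∷ suc zero ∷ suc zero ∷ zero ∷ []

-- The juxtaposition σ(τ+2).
_⟨_+2⟩ : ∀ {k} → Word 2 → Word k → Word (2 + k)
_⟨_+2⟩ {k} σ τ = Vec.map (_↑ˡ k) σ Vec.++ Vec.map (2 ↑ʳ_) τ

catalan : ℕ → ℕ
catalan n = ((2 * n) C n) / suc n

-- f a + f (a + 1) + ⋯ + f b, empty when b < a.
∑ : ℕ → ℕ → (ℕ → ℕ) → ℕ
∑ a b f = sum (applyUpTo (λ i → f (a + i)) (suc b ∸ a))

{-# OPTIONS --safe #-}
module Submission where

-- Read a matching from left to right, up to the first letter that completes an
-- occurrence of σ.  The matching avoids σ(τ+2) iff no such letter exists or the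
-- part after it avoids τ.  If h edges are open at that point, deleting
-- their right ends from the remaining L letters leaves a τ-avoiding matching, so
-- there are (L C h) * h! * |𝓜(τ)| ways to continue.
--
-- Before that point, call an open edge dangerous if closing it completes σ.
-- Closing a safe edge makes dangerous the safe edges opened later (σ = 1212) or
-- earlier (σ = 1221); so only the numbers of dangerous and safe edges matter,
-- and both patterns give the same recursion.  Announcing at its opening whether
-- an edge is closed before or after σ is completed turns the recursion into
-- ballot paths with one step −2, shuffled with the openings of the
-- edges that stay open.

open import Defs
open import Data.Bool using (Bool; true; false; not; if_then_else_)
open import Data.Empty using (⊥-elim)
open import Data.Fin as Fin using (Fin; zero; suc; toℕ; fromℕ<)
import Data.Fin.Properties as Fin
open import Data.List using (List; []; _∷_; [_]; _++_; map; concatMap; length; filter; null; applyUpTo; tabulate)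
open import Data.List.Properties using (++-assoc; ++-identityʳ; map-++; map-∘; ∷-injective; ∷-injectiveʳ; filter-all; filter-accept; filter-reject; length-++; length-map; tabulate-cong; map-tabulate)
open import Data.List.Membership.Propositional using (_∈_; _∉_; find)
open import Data.List.Membership.Propositional.Properties
open import Data.List.Membership.Propositional.Properties.WithK using (unique∧set⇒bag)
open import Data.List.Relation.Binary.BagAndSetEquality using (∼bag⇒↭)
open import Data.List.Relation.Binary.Permutation.Propositional.Properties using (↭-length)
open import Data.List.Relation.Binary.Sublist.Propositional using (_⊆_; []; _∷_; _∷ʳ_; ⊆-refl; ⊆-trans; ⊆-reflexive; minimum; from∈; to∈; lookup)
import Data.List.Relation.Binary.Sublist.Propositional.Properties as Sublist
open import Data.List.Relation.Binary.Sublist.Propositional.Properties using (++⁺; ++⁺ˡ; ++⁺ʳ; All-resp-⊆; ∷ˡ⁻; filter-⊆; filter⁺)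
open import Data.List.Relation.Unary.All as All using (All; []; _∷_)
import Data.List.Relation.Unary.All.Properties as All
open import Data.List.Relation.Unary.AllPairs as AllPairs using (AllPairs; []; _∷_)
import Data.List.Relation.Unary.AllPairs.Properties as AllPairs
open import Data.List.Relation.Unary.Any as Any using (here; there)
open import Data.List.Relation.Unary.Unique.Propositional using (Unique)
import Data.List.Relation.Unary.Unique.Propositional.Properties as Unique
open import Data.Nat
open import Data.Nat.Combinatorics using (_C_; nC1≡n; nCn≡1; nCk≡nC[n∸k]; k>n⇒nCk≡0; nCk+nC[k+1]≡[n+1]C[k+1])
open import Data.Nat.DivMod using (m*n/n≡m; /-congˡ)
open import Data.Nat.ListAction using (sum)
open import Data.Nat.ListAction.Properties using (sum-++)
open import Data.Nat.Properties
open import Data.Nat.Tactic.RingSolver using (solve-∀)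
open import Data.Product using (∃; ∃₂; _×_; _,_; proj₁; proj₂)
open import Data.Sum as Sum using (_⊎_; inj₁; inj₂; [_,_]′)
open import Data.Vec as Vec using (Vec; []; _∷_; toList)
import Data.Vec.Properties as Vec
open import Function using (_∘_; flip; id; case_of_)
open import Function.Bundles using (_⇔_; mk⇔; Equivalence)
open import Algebra.Properties.CommutativeSemigroup +-commutativeSemigroup using (interchange)
open import Relation.Binary.Definitions using (tri<; tri≈; tri>)
open import Relation.Binary.PropositionalEquality hiding ([_])
open import Relation.Nullary using (¬_; Dec; yes; no; does; contradiction)
open import Relation.Nullary.Decidable using (map′; ¬?; _⊎-dec_; does-⇔; dec-true; dec-false)

open Equivalence using (to; from)
open ≡-Reasoning

-- Ballot paths and binomial coefficients

-- Origin of the step -2: an edge announced to close before σ is completed must not become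
-- dangerous, unless it is the very edge that completes σ. So when a safe edge is closed, at most
-- one announced edge may lie on the side that becomes dangerous. If there is none, the closed edge
-- is forced: it is the outermost announced edge on that side, and the height drops by 1. If there
-- is one, that edge will complete σ, and it leaves the announced safe edges together with the
-- closed one: the height drops by 2. This happens exactly once if σ occurs, and never otherwise;
-- the latter case gives the Catalan number.
--
-- In the formula, ℓ is the number of edges closed once σ is completed and k the number of edges
-- open at that moment. The ℓ edges have 2ℓ - 1 letters before the completing one: ℓ steps up, one
-- step -2 and ℓ - 2 steps -1. The first binomial coefficient counts these paths, the second
-- shuffles in the k openings, and the third places k right ends among the remaining 2(n - ℓ) - k
-- letters.

antidiag : (ℕ → ℕ → ℕ) → ℕ → ℕ
antidiag F zero    = 0
antidiag F (suc s) = F 0 s + antidiag (F ∘ suc) s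

antidiag-cong : ∀ {F G} s → (∀ i j → suc (i + j) ≡ s → F i j ≡ G i j) →
  antidiag F s ≡ antidiag G s
antidiag-cong zero    eq = refl
antidiag-cong (suc s) eq =
  cong₂ _+_ (eq 0 s refl) (antidiag-cong s λ i j p → eq (suc i) j (cong suc p))

antidiag-+ : ∀ F G s → antidiag (λ i j → F i j + G i j) s ≡ antidiag F s + antidiag G s
antidiag-+ F G zero    = refl
antidiag-+ F G (suc s) rewrite antidiag-+ (F ∘ suc) (G ∘ suc) s =
  interchange (F 0 s) (G 0 s) (antidiag (F ∘ suc) s) (antidiag (G ∘ suc) s)

antidiag-snoc : ∀ F s → antidiag F (suc s) ≡ antidiag (λ i j → F i (suc j)) s + F s 0
antidiag-snoc F zero    = +-identityʳ (F 0 0)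
antidiag-snoc F (suc s) =
  trans (cong (F 0 (suc s) +_) (antidiag-snoc (F ∘ suc) s))
        (sym (+-assoc (F 0 (suc s)) _ (F (suc s) 0)))

antidiag-flip : ∀ F s → antidiag (flip F) s ≡ antidiag F s
antidiag-flip F zero    = refl
antidiag-flip F (suc s) = begin
  F s 0 + antidiag (flip (λ i j → F i (suc j))) s ≡⟨ cong (F s 0 +_) (antidiag-flip _ s) ⟩
  F s 0 + antidiag (λ i j → F i (suc j)) s        ≡⟨ +-comm (F s 0) _ ⟩
  antidiag (λ i j → F i (suc j)) s + F s 0        ≡⟨ antidiag-snoc F s ⟨
  antidiag F (suc s)                              ∎

-- The value 0 at height 0 stands for a step down that is impossible there.
shift : (ℕ → ℕ) → ℕ → ℕ
shift F zero    = 0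
shift F (suc s) = F s

-- Σⱼ (s C j) * F j, computed by Pascal's rule.
binomialTransform : ℕ → (ℕ → ℕ) → ℕ
binomialTransform zero    F = F 0
binomialTransform (suc s) F = binomialTransform s F + binomialTransform s (F ∘ suc)

binomialTransform-cong : ∀ s {F G : ℕ → ℕ} → (∀ j → F j ≡ G j) →
  binomialTransform s F ≡ binomialTransform s G
binomialTransform-cong zero    eq = eq 0
binomialTransform-cong (suc s) eq =
  cong₂ _+_ (binomialTransform-cong s eq) (binomialTransform-cong s (eq ∘ suc))

binomialTransform-+ : ∀ s F G →
  binomialTransform s (λ j → F j + G j) ≡ binomialTransform s F + binomialTransform s G
binomialTransform-+ zero    F G = refl
binomialTransform-+ (suc s) F G
  rewrite binomialTransform-+ s F G | binomialTransform-+ s (F ∘ suc) (G ∘ suc) =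
  interchange (binomialTransform s F) (binomialTransform s G) _ _

binomialTransform-* : ∀ s c F → binomialTransform s (λ j → c * F j) ≡ c * binomialTransform s F
binomialTransform-* zero    c F = refl
binomialTransform-* (suc s) c F
  rewrite binomialTransform-* s c F | binomialTransform-* s c (F ∘ suc) =
  sym (*-distribˡ-+ c (binomialTransform s F) _)

binomialTransform-0 : ∀ s → binomialTransform s (λ _ → 0) ≡ 0
binomialTransform-0 zero    = refl
binomialTransform-0 (suc s) = cong₂ _+_ (binomialTransform-0 s) (binomialTransform-0 s)

δ : ℕ → ℕ
δ zero    = 1
δ (suc _) = 0

binomialTransform-δ : ∀ s → binomialTransform s δ ≡ 1
binomialTransform-δ zero    = refl
binomialTransform-δ (suc s) = cong₂ _+_ (binomialTransform-δ s) (binomialTransform-0 s)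

-- Picking one element of a row and a subset of those after it amounts to picking a nonempty subset,
-- with the first pick as its first element. This is why the announced edge to be closed next is
-- forced.
antidiag-binomialTransform : ∀ F s →
  antidiag (λ i j → binomialTransform j F) s ≡ binomialTransform s (shift F)
antidiag-binomialTransform F zero    = refl
antidiag-binomialTransform F (suc s)
  rewrite antidiag-binomialTransform F s = +-comm (binomialTransform s F) _

-- The weight `i` marks one element before the picked one. Marked element, picked element and subset
-- together form a subset of at least two elements, of which the first two are the marked and the
-- picked one. The double `shift` becomes the step -2; the weight `c` just repeats the previous
-- identity.
antidiag-weighted-binomialTransform : ∀ F c s →
  antidiag (λ i j → (c + i) * binomialTransform j F) s ≡
  c * binomialTransform s (shift F) + binomialTransform s (shift (shift F))
antidiag-weighted-binomialTransform F c zero    = sym (trans (+-identityʳ (c * 0)) (*-zeroʳ c))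
antidiag-weighted-binomialTransform F c (suc s) = begin
  (c + 0) * b + antidiag (λ i j → (c + suc i) * binomialTransform j F) s
    ≡⟨ cong ((c + 0) * b +_) (antidiag-cong s λ i j _ → cong (_* binomialTransform j F) (+-suc c i)) ⟩
  (c + 0) * b + antidiag (λ i j → (suc c + i) * binomialTransform j F) s
    ≡⟨ cong ((c + 0) * b +_) (antidiag-weighted-binomialTransform F (suc c) s) ⟩
  (c + 0) * b + (suc c * b₁ + b₂)
    ≡⟨ regroup c b b₁ b₂ ⟩
  c * (b₁ + b) + (b₂ + b₁) ∎
  where
  b b₁ b₂ : ℕ
  b  = binomialTransform s F
  b₁ = binomialTransform s (shift F)
  b₂ = binomialTransform s (shift (shift F))
  regroup : ∀ c b b₁ b₂ → (c + 0) * b + ((1 + c) * b₁ + b₂) ≡ c * (b₁ + b) + (b₂ + b₁)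
  regroup = solve-∀

-- Paths of L steps ±1 from height s to 0 that never go below 0.
ballot : ℕ → ℕ → ℕ
ballot s zero    = δ s
ballot s (suc L) = ballot (suc s) L + shift (λ j → ballot j L) s

-- The same with exactly one additional step −2, which is counted in the length.
ballot₂ : ℕ → ℕ → ℕ
ballot₂ s zero    = 0
ballot₂ s (suc L) = ballot₂ (suc s) L + shift (λ j → ballot₂ j L) s + shift (shift (λ j → ballot j L)) s

-- Both sides count the ways in which s open edges and further ones are closed
-- with a distinguished edge last: on the right by the place where that edge is
-- opened (it is one of the s, or a new one), on the left according to whether
-- its closing completes σ (ballot₂) or not.
ballot₂-ballot : ∀ s m → ballot₂ s m + ballot s (suc m) ≡
  s * shift (λ j → ballot j m) s + m * ballot s (pred m)
ballot₂-ballot zero          zero    = refl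
ballot₂-ballot (suc zero)    zero    = refl
ballot₂-ballot (suc (suc s)) zero    = sym (trans (+-identityʳ (s * 0)) (*-zeroʳ s))
ballot₂-ballot s (suc m) = step s m
  where
  scaled-step : ∀ m s → m * ballot (suc s) (pred m) + m * shift (λ j → ballot j (pred m)) s ≡ m * ballot s m
  scaled-step zero    s = refl
  scaled-step (suc m) s = sym (*-distribˡ-+ (suc m) (ballot (suc s) m) _)
  step : ∀ s m → ballot₂ s (suc m) + ballot s (suc (suc m)) ≡
    s * shift (λ j → ballot j (suc m)) s + suc m * ballot s m
  step zero m = begin
    ballot₂ 1 m + 0 + 0 + (ballot 1 (suc m) + 0) ≡⟨ r₁ (ballot₂ 1 m) (ballot 1 (suc m)) ⟩
    ballot₂ 1 m + ballot 1 (suc m)               ≡⟨ ballot₂-ballot 1 m ⟩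
    1 * ballot 0 m + m * ballot 1 (pred m)       ≡⟨ r₂ (ballot 0 m) _ ⟩
    m * ballot 1 (pred m) + 0 + ballot 0 m       ≡⟨ cong (λ z → m * ballot 1 (pred m) + z + ballot 0 m) (*-zeroʳ m) ⟨
    m * ballot 1 (pred m) + m * 0 + ballot 0 m   ≡⟨ cong (_+ ballot 0 m) (scaled-step m 0) ⟩
    m * ballot 0 m + ballot 0 m                  ≡⟨ +-comm (m * ballot 0 m) _ ⟩
    suc m * ballot 0 m                           ∎
    where
    r₁ : ∀ a b → a + 0 + 0 + (b + 0) ≡ a + b
    r₁ = solve-∀
    r₂ : ∀ a b → 1 * a + b ≡ b + 0 + a
    r₂ = solve-∀
  step (suc s) m = begin
    a₂ + a₀ + d + (b₂ + b₀)                   ≡⟨ r₁ a₂ a₀ d b₂ b₀ ⟩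
    (a₂ + b₂) + (a₀ + b₀) + d                 ≡⟨ cong₂ (λ x y → x + y + d) (ballot₂-ballot (2 + s) m) (ballot₂-ballot s m) ⟩
    ((2 + s) * g₁ + m * h₂) + (s * d + m * h₀) + d ≡⟨ r₂ s m g₁ h₂ d h₀ ⟩
    suc s * (g₁ + d) + (m * h₂ + m * h₀) + g₁ ≡⟨ cong (λ x → suc s * (g₁ + d) + x + g₁) (scaled-step m (suc s)) ⟩
    suc s * (g₁ + d) + m * g₁ + g₁            ≡⟨ r₃ s m (g₁ + d) g₁ ⟩
    suc s * (g₁ + d) + suc m * g₁             ∎
    where
    a₂ a₀ d b₂ b₀ g₁ h₂ h₀ : ℕ
    a₂ = ballot₂ (2 + s) m
    a₀ = ballot₂ s m
    d  = shift (λ j → ballot j m) s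
    b₂ = ballot (2 + s) (suc m)
    b₀ = ballot s (suc m)
    g₁ = ballot (suc s) m
    h₂ = ballot (2 + s) (pred m)
    h₀ = ballot s (pred m)
    r₁ : ∀ a₂ a₀ d b₂ b₀ → a₂ + a₀ + d + (b₂ + b₀) ≡ (a₂ + b₂) + (a₀ + b₀) + d
    r₁ = solve-∀
    r₂ : ∀ s m g₁ h₂ d h₀ → ((2 + s) * g₁ + m * h₂) + (s * d + m * h₀) + d ≡
      (1 + s) * (g₁ + d) + (m * h₂ + m * h₀) + g₁
    r₂ = solve-∀
    r₃ : ∀ s m x g₁ → (1 + s) * x + m * g₁ + g₁ ≡ (1 + s) * x + (1 + m) * g₁
    r₃ = solve-∀

-- Closed forms of the ballot numbers

absorption : ∀ n k → suc k * (suc n C suc k) ≡ suc n * (n C k)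
absorption zero    zero    = refl
absorption zero    (suc k) = trans (cong (suc (suc k) *_) (k>n⇒nCk≡0 {1} {suc (suc k)} (s≤s (s≤s z≤n)))) (*-zeroʳ (suc (suc k)))
absorption (suc n) zero    = trans (*-identityˡ (suc (suc n) C 1)) (trans (nC1≡n (suc (suc n))) (sym (*-identityʳ (suc (suc n)))))
absorption (suc n) (suc k) = begin
  (2 + k) * (suc (suc n) C suc (suc k))
    ≡⟨ cong ((2 + k) *_) (nCk+nC[k+1]≡[n+1]C[k+1] (suc n) (suc k)) ⟨
  (2 + k) * (x + suc n C suc (suc k))                ≡⟨ r₁ k x (suc n C suc (suc k)) ⟩
  x + suc k * x + (2 + k) * (suc n C suc (suc k))
    ≡⟨ cong₂ (λ y z → x + y + z) (absorption n k) (absorption n (suc k)) ⟩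
  x + suc n * (n C k) + suc n * (n C suc k)          ≡⟨ r₂ x n (n C k) (n C suc k) ⟩
  x + suc n * (n C k + n C suc k)                    ≡⟨ cong (λ y → x + suc n * y) (nCk+nC[k+1]≡[n+1]C[k+1] n k) ⟩
  (2 + n) * x                                        ∎
  where
  x : ℕ
  x = suc n C suc k
  r₁ : ∀ k x y → (2 + k) * (x + y) ≡ x + (1 + k) * x + (2 + k) * y
  r₁ = solve-∀
  r₂ : ∀ x n a b → x + (1 + n) * a + (1 + n) * b ≡ x + (1 + n) * (a + b)
  r₂ = solve-∀

absorption′ : ∀ n k → suc k * (n C suc k) + k * (n C k) ≡ n * (n C k)
absorption′ n k = +-cancelˡ-≡ (n C k) _ _ (begin
  n C k + (suc k * (n C suc k) + k * (n C k)) ≡⟨ r k (n C k) (n C suc k) ⟩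
  suc k * (n C k + n C suc k)                 ≡⟨ cong (suc k *_) (nCk+nC[k+1]≡[n+1]C[k+1] n k) ⟩
  suc k * (suc n C suc k)                     ≡⟨ absorption n k ⟩
  suc n * (n C k)                             ∎)
  where
  r : ∀ k x y → x + ((1 + k) * y + k * x) ≡ (1 + k) * (x + y)
  r = solve-∀

central-symmetry : ∀ v → suc (v + v) C v ≡ suc (v + v) C suc v
central-symmetry v = trans (nCk≡nC[n∸k] (m≤n⇒m≤1+n (m≤m+n v v)))
  (cong (suc (v + v) C_) (trans (+-∸-assoc 1 (m≤m+n v v)) (cong suc (m+n∸m≡n v v))))

ballot-unreachable : ∀ s L → L < s → ballot s L ≡ 0
ballot-unreachable (suc s) zero    p = refl
ballot-unreachable (suc s) (suc L) p =
  cong₂ _+_ (ballot-unreachable (2 + s) L (m<n⇒m<1+n (<-trans (n<1+n L) p)))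
            (ballot-unreachable s L (s≤s⁻¹ p))

-- The reflection principle in additive form: `u` is the number of steps up, and `shift (L C_) u`
-- counts the step sequences that go below 0. The induction on `L` only uses Pascal's rule.
ballot-closed : ∀ L s u → L ≡ u + (s + u) → ballot s L + shift (L C_) u ≡ L C u
ballot-closed zero    zero    zero    eq = refl
ballot-closed (suc L) s       (suc v) eq = begin
  ballot s (suc L) + suc L C v
    ≡⟨ cong (ballot s (suc L) +_) (pascal v) ⟨
  ballot (suc s) L + shift (λ j → ballot j L) s + (shift (L C_) v + L C v)
    ≡⟨ r (ballot (suc s) L) _ (shift (L C_) v) _ ⟩
  (ballot (suc s) L + shift (L C_) v) + (shift (λ j → ballot j L) s + L C v)
    ≡⟨ cong₂ _+_ (ballot-closed L (suc s) v L≡) (down s L≡) ⟩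
  L C v + L C suc v
    ≡⟨ nCk+nC[k+1]≡[n+1]C[k+1] L v ⟩
  suc L C suc v ∎
  where
  L≡ : L ≡ v + (suc s + v)
  L≡ = trans (suc-injective eq) (cong (v +_) (+-suc s v))
  pascal : ∀ v → shift (L C_) v + L C v ≡ suc L C v
  pascal zero    = refl
  pascal (suc v) = nCk+nC[k+1]≡[n+1]C[k+1] L v
  down : ∀ s → L ≡ v + (suc s + v) → shift (λ j → ballot j L) s + L C v ≡ L C suc v
  -- From height 0 there is no step down; instead the two middle coefficients of the odd row `L`
  -- agree.
  down zero    e rewrite trans e (+-suc v v) = central-symmetry v
  down (suc s) e = ballot-closed L s (suc v) (trans e (trans (+-suc v (suc s + v)) (cong (λ x → suc (v + x)) (sym (+-suc s v)))))
  r : ∀ a b c d → a + b + (c + d) ≡ (a + c) + (b + d)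
  r = solve-∀
ballot-closed (suc L) (suc s) zero    eq = begin
  ballot (2 + s) L + ballot s L + 0 ≡⟨ +-identityʳ _ ⟩
  ballot (2 + s) L + ballot s L     ≡⟨ cong (_+ ballot s L) (ballot-unreachable (2 + s) L (s≤s (≤-trans (≤-reflexive L≡) (≤-trans (≤-reflexive (+-identityʳ s)) (n≤1+n s))))) ⟩
  ballot s L                        ≡⟨ +-identityʳ _ ⟨
  ballot s L + 0                    ≡⟨ ballot-closed L s zero L≡ ⟩
  L C 0                             ≡⟨⟩
  suc L C 0                         ∎
  where
  L≡ : L ≡ s + 0
  L≡ = suc-injective eq

ballot-odd : ∀ L s u → L ≡ suc (u + u + s) → ballot s L ≡ 0
ballot-odd (suc L) s u eq = cong₂ _+_ (up u eq) (down s eq)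
  where
  up : ∀ u → suc L ≡ suc (u + u + s) → ballot (suc s) L ≡ 0
  up zero    e = ballot-unreachable (suc s) L (s≤s (≤-reflexive (suc-injective e)))
  up (suc u) e = ballot-odd L (suc s) u
    (trans (suc-injective e) (trans (cong (λ x → suc (x + s)) (+-suc u u)) (cong suc (sym (+-suc (u + u) s)))))
  down : ∀ s → suc L ≡ suc (u + u + s) → shift (λ j → ballot j L) s ≡ 0
  down zero    e = refl
  down (suc s) e = ballot-odd L s u (trans (suc-injective e) (+-suc (u + u) s))

-- Reflection gives the difference of `X` and `Y`, and absorption makes `suc v * X` equal to
-- `(2 + v) * Y`. Adding `suc v * X` on both sides replaces the subtraction.
ballot-central : ∀ n → ballot 0 (n + n) * suc n ≡ (n + n) C n
ballot-central zero    = refl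
ballot-central (suc v) = +-cancelʳ-≡ (suc v * X) _ _ (begin
  g * (2 + v) + suc v * X   ≡⟨ cong (g * (2 + v) +_) [1+v]X ⟩
  g * (2 + v) + (2 + v) * Y ≡⟨ r₁ g v Y ⟩
  (2 + v) * (g + Y)         ≡⟨ cong ((2 + v) *_) (ballot-closed N 0 (suc v) refl) ⟩
  (2 + v) * X               ≡⟨⟩
  X + suc v * X             ∎)
  where
  N g X Y : ℕ
  N = suc v + suc v
  g = ballot 0 N
  X = N C suc v
  Y = N C v
  r₁ : ∀ g v y → g * (2 + v) + (2 + v) * y ≡ (2 + v) * (g + y)
  r₁ = solve-∀
  r₂ : ∀ v y → (1 + v + (1 + v)) * y ≡ (2 + v) * y + v * y
  r₂ = solve-∀
  [1+v]X : suc v * X ≡ (2 + v) * Y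
  [1+v]X = +-cancelʳ-≡ (v * Y) _ _ (trans (absorption′ N v) (r₂ v Y))

-- With ℓ = j + 2 this is the first binomial coefficient of the formula. At height 0,
-- `ballot₂-ballot` expresses the unknown through two consecutive Catalan numbers; `N` times the
-- smaller one is `x` by absorption, and it remains to see that `x` exceeds `N C j` by the larger
-- one.
ballot₂-closed : ∀ j → ballot₂ 0 (suc (suc j + suc j)) ≡ suc (suc j + suc j) C j
ballot₂-closed j = +-cancelʳ-≡ (ballot 0 (suc N)) _ _ (begin
  ballot₂ 0 N + ballot 0 (suc N)  ≡⟨ ballot₂-ballot 0 N ⟩
  N * ballot 0 (suc j + suc j)    ≡⟨ *-cancelˡ-≡ _ _ (2 + j) scaled ⟩
  x                               ≡⟨ +-cancelʳ-≡ x _ _ doubled ⟨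
  N C j + ballot 0 (suc N)        ∎)
  where
  N x : ℕ
  N = suc (suc j + suc j)
  x = N C (2 + j)
  r : ∀ j N g → (2 + j) * (N * g) ≡ N * (g * (2 + j))
  r = solve-∀
  scaled : (2 + j) * (N * ballot 0 (suc j + suc j)) ≡ (2 + j) * x
  scaled = begin
    (2 + j) * (N * ballot 0 (suc j + suc j)) ≡⟨ r j N (ballot 0 (suc j + suc j)) ⟩
    N * (ballot 0 (suc j + suc j) * (2 + j)) ≡⟨ cong (N *_) (ballot-central (suc j)) ⟩
    N * ((suc j + suc j) C suc j)            ≡⟨ absorption (suc j + suc j) (suc j) ⟨
    (2 + j) * x                              ∎
  symm : N C suc j ≡ x
  symm = central-symmetry (suc j)
  -- A second copy of `x`, read as `N C suc j`, lets Pascal's rule pass to row `suc N`, where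
  -- `ballot-closed` applies.
  doubled : N C j + ballot 0 (suc N) + x ≡ x + x
  doubled = begin
    N C j + ballot 0 (suc N) + x           ≡⟨ cong (N C j + ballot 0 (suc N) +_) symm ⟨
    N C j + ballot 0 (suc N) + N C suc j   ≡⟨ r₁ (N C j) _ (N C suc j) ⟩
    ballot 0 (suc N) + (N C j + N C suc j) ≡⟨ cong (ballot 0 (suc N) +_) (nCk+nC[k+1]≡[n+1]C[k+1] N j) ⟩
    ballot 0 (suc N) + suc N C suc j       ≡⟨ ballot-closed (suc N) 0 (2 + j) (cong (2 +_) (sym (+-suc j (suc j)))) ⟩
    suc N C (2 + j)                        ≡⟨ nCk+nC[k+1]≡[n+1]C[k+1] N (suc j) ⟨
    N C suc j + x                          ≡⟨ cong (_+ x) symm ⟩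
    x + x                                  ∎
    where
    r₁ : ∀ a b c → a + b + c ≡ b + (a + c)
    r₁ = solve-∀

-- Parity: beside the step -2 there is an odd number of steps ±1. The proof reads this off from
-- `ballot₂-ballot`, whose right side vanishes by `ballot-odd`.
ballot₂-even : ∀ u → ballot₂ 0 (u + u) ≡ 0
ballot₂-even zero    = refl
ballot₂-even (suc u) = m+n≡0⇒m≡0 _ (begin
  ballot₂ 0 (suc u + suc u) + ballot 0 (suc (suc u + suc u))
    ≡⟨ ballot₂-ballot 0 (suc u + suc u) ⟩
  (suc u + suc u) * ballot 0 (u + suc u)
    ≡⟨ cong ((suc u + suc u) *_) (ballot-odd (u + suc u) 0 u (trans (+-suc u u) (cong suc (sym (+-identityʳ _))))) ⟩
  (suc u + suc u) * 0
    ≡⟨ *-zeroʳ (suc u + suc u) ⟩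
  0 ∎)

-- Sums over initial segments of the natural numbers

sumTo : ℕ → (ℕ → ℕ) → ℕ
sumTo N f = sum (applyUpTo f N)

sumTo-cong : ∀ N {f g : ℕ → ℕ} → (∀ i → i < N → f i ≡ g i) → sumTo N f ≡ sumTo N g
sumTo-cong zero    eq = refl
sumTo-cong (suc N) eq = cong₂ _+_ (eq 0 z<s) (sumTo-cong N λ i i<N → eq (suc i) (s<s i<N))

sumTo-+ : ∀ N f g → sumTo N (λ i → f i + g i) ≡ sumTo N f + sumTo N g
sumTo-+ zero    f g = refl
sumTo-+ (suc N) f g rewrite sumTo-+ N (f ∘ suc) (g ∘ suc) =
  interchange (f 0) (g 0) (sumTo N (f ∘ suc)) (sumTo N (g ∘ suc))

sumTo-0 : ∀ N {f : ℕ → ℕ} → (∀ i → f i ≡ 0) → sumTo N f ≡ 0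
sumTo-0 zero    eq = refl
sumTo-0 (suc N) eq = cong₂ _+_ (eq 0) (sumTo-0 N (eq ∘ suc))

sumTo-truncate : ∀ K N {f : ℕ → ℕ} → K ≤ N → (∀ i → K ≤ i → f i ≡ 0) → sumTo N f ≡ sumTo K f
sumTo-truncate zero    N       K≤N eq = sumTo-0 N λ i → eq i z≤n
sumTo-truncate (suc K) (suc N) K≤N eq =
  cong (_ +_) (sumTo-truncate K N (s≤s⁻¹ K≤N) λ i K≤i → eq (suc i) (s≤s K≤i))

sumTo-odd : ∀ n {f : ℕ → ℕ} → (∀ i → f (i + i) ≡ 0) → sumTo (n + n) f ≡ sumTo n (λ i → f (suc (i + i)))
sumTo-odd zero        eq = refl
sumTo-odd (suc n) {f} eq rewrite +-suc n n = begin
  f 0 + (f 1 + sumTo (n + n) (λ i → f (2 + i))) ≡⟨ cong (_+ (f 1 + sumTo (n + n) (λ i → f (2 + i)))) (eq 0) ⟩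
  f 1 + sumTo (n + n) (λ i → f (2 + i))
    ≡⟨ cong (f 1 +_) (sumTo-odd n λ i → trans (cong (λ i → f (suc i)) (sym (+-suc i i))) (eq (suc i))) ⟩
  f 1 + sumTo n (λ i → f (suc (suc (suc (i + i)))))
    ≡⟨ cong (f 1 +_) (sumTo-cong n λ i _ → cong (λ i → f (2 + i)) (sym (+-suc i i))) ⟩
  f 1 + sumTo n (λ i → f (suc (suc i + suc i))) ∎

-- S h L is the number of ways to continue a word by L more letters after the
-- letter that completes the first occurrence of σ, if h edges are open.
module Counting (S : ℕ → ℕ → ℕ) where

  -- Completions by L letters when t open edges are dangerous (closing one of
  -- them completes an occurrence of σ) and s are safe; closing a safe edge
  -- makes the i safe edges on one side of it dangerous.
  completions : ℕ → ℕ → ℕ → ℕ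
  completions t s zero    = δ (t + s)
  completions t s (suc L) =
    completions t (suc s) L + antidiag (λ i j → completions (t + i) j L) s + t * S (pred (t + s)) L

  -- The same when it is announced at the opening of an edge whether the edge
  -- will be closed before or after σ first occurs.  Of the K open edges, s are
  -- safe and will be closed before; G₁ has in addition the edge whose closing
  -- completes σ.
  G₁ : ℕ → ℕ → ℕ → ℕ
  G₁ s K zero    = 0
  G₁ s K (suc L) = G₁ s (suc K) L + G₁ (suc s) (suc K) L +
    shift (λ j → G₁ j (pred K) L) s + δ s * S (pred K) L

  G₀ : ℕ → ℕ → ℕ → ℕ
  G₀ s K zero    = 0
  G₀ s K (suc L) = G₀ s (suc K) L + G₀ (suc s) (suc K) L +
    shift (λ j → G₀ j (pred K) L) s + shift (shift (λ j → G₁ j (pred K) L)) s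

  -- `binomialTransform s` chooses which safe edges are announced to close before σ is completed. If
  -- σ never occurs, no dangerous edge may be open and every safe edge gets closed: the first
  -- summand. Otherwise the completing edge is one of the `t` dangerous ones (`G₁`) or is still to
  -- become dangerous (`G₀`).
  completions-announced : ∀ L t s → completions t s L ≡
    δ t * ballot s L + (t * binomialTransform s (λ j → G₁ j (t + s) L) + binomialTransform s (λ j → G₀ j (t + s) L))
  completions-announced zero t s
    rewrite binomialTransform-0 s | *-zeroʳ t = trans (δ-+ t s) (sym (+-identityʳ _))
    where
    δ-+ : ∀ t s → δ (t + s) ≡ δ t * δ s
    δ-+ zero    s = sym (+-identityʳ (δ s))
    δ-+ (suc t) s = refl
  completions-announced (suc L) t s = begin
    completions t (suc s) L + antidiag (λ i j → completions (t + i) j L) s + t * c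
      ≡⟨ cong₂ (λ x y → x + y + t * c) opening closing ⟩
    d * ballot (suc s) L + (t * (p₁ + p₂) + (q₁ + q₂)) + (d * shift (λ j → ballot j L) s + (t * p₃ + p₄ + q₃)) + t * c
      ≡⟨ r d t (ballot (suc s) L) (shift (λ j → ballot j L) s) p₁ p₂ p₃ p₄ q₁ q₂ q₃ c ⟩
    d * ballot s (suc L) + (t * (p₁ + p₂ + p₃ + c) + (q₁ + q₂ + q₃ + p₄))
      ≡⟨ cong₂ (λ x y → d * ballot s (suc L) + (t * x + y)) sumG₁ sumG₀ ⟨
    d * ballot s (suc L) + (t * binomialTransform s (λ j → G₁ j K (suc L)) + binomialTransform s (λ j → G₀ j K (suc L))) ∎
    where
    K c d p₁ p₂ p₃ p₄ q₁ q₂ q₃ : ℕ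
    K = t + s
    c = S (pred K) L
    d = δ t
    p₁ = binomialTransform s (λ j → G₁ j (suc K) L)
    p₂ = binomialTransform s (λ j → G₁ (suc j) (suc K) L)
    p₃ = binomialTransform s (shift (λ j → G₁ j (pred K) L))
    p₄ = binomialTransform s (shift (shift (λ j → G₁ j (pred K) L)))
    q₁ = binomialTransform s (λ j → G₀ j (suc K) L)
    q₂ = binomialTransform s (λ j → G₀ (suc j) (suc K) L)
    q₃ = binomialTransform s (shift (λ j → G₀ j (pred K) L))

    r : ∀ d t b₁ b₂ p₁ p₂ p₃ p₄ q₁ q₂ q₃ c →
      d * b₁ + (t * (p₁ + p₂) + (q₁ + q₂)) + (d * b₂ + (t * p₃ + p₄ + q₃)) + t * c ≡
      d * (b₁ + b₂) + (t * (p₁ + p₂ + p₃ + c) + (q₁ + q₂ + q₃ + p₄))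
    r = solve-∀

    sum₄ : ∀ s (F₁ F₂ F₃ F₄ : ℕ → ℕ) → binomialTransform s (λ j → F₁ j + F₂ j + F₃ j + F₄ j) ≡
      binomialTransform s F₁ + binomialTransform s F₂ + binomialTransform s F₃ + binomialTransform s F₄
    sum₄ s F₁ F₂ F₃ F₄
      rewrite binomialTransform-+ s (λ j → F₁ j + F₂ j + F₃ j) F₄
            | binomialTransform-+ s (λ j → F₁ j + F₂ j) F₃
            | binomialTransform-+ s F₁ F₂ = refl

    -- The completing edge may be closed only when no announced edge is left, so just the empty
    -- choice contributes.
    sumδ : binomialTransform s (λ j → δ j * c) ≡ c
    sumδ = begin
      binomialTransform s (λ j → δ j * c) ≡⟨ binomialTransform-cong s (λ j → *-comm (δ j) c) ⟩
      binomialTransform s (λ j → c * δ j) ≡⟨ binomialTransform-* s c δ ⟩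
      c * binomialTransform s δ           ≡⟨ cong (c *_) (binomialTransform-δ s) ⟩
      c * 1                               ≡⟨ *-identityʳ c ⟩
      c                                   ∎

    sumG₁ : binomialTransform s (λ j → G₁ j K (suc L)) ≡ p₁ + p₂ + p₃ + c
    sumG₁ = trans (sum₄ s _ _ _ _) (cong (p₁ + p₂ + p₃ +_) sumδ)

    sumG₀ : binomialTransform s (λ j → G₀ j K (suc L)) ≡ q₁ + q₂ + q₃ + p₄
    sumG₀ = sum₄ s _ _ _ _

    opening : completions t (suc s) L ≡ d * ballot (suc s) L + (t * (p₁ + p₂) + (q₁ + q₂))
    opening = trans (completions-announced L t (suc s))
      (cong (λ k → d * ballot (suc s) L +
          (t * binomialTransform (suc s) (λ j → G₁ j k L) + binomialTransform (suc s) (λ j → G₀ j k L)))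
        (+-suc t s))

    -- If σ is never to occur, a closing must not make any edge dangerous: only the term with
    -- `t + i ≡ 0` survives.
    ballots : ∀ t s → antidiag (λ i j → δ (t + i) * ballot j L) s ≡ δ t * shift (λ j → ballot j L) s
    ballots t       zero    = sym (*-zeroʳ (δ t))
    ballots zero    (suc s) = trans (cong (1 * ballot s L +_) (vanish s)) (+-identityʳ _)
      where
      vanish : ∀ s → antidiag (λ i j → 0) s ≡ 0
      vanish zero    = refl
      vanish (suc s) = vanish s
    ballots (suc t) (suc s) = ballots (suc t) s

    total : ∀ i j → suc (i + j) ≡ s → t + i + j ≡ pred K
    total i j refl = trans (+-assoc t i j) (sym (cong pred (+-suc t (i + j))))

    closing : antidiag (λ i j → completions (t + i) j L) s ≡
      d * shift (λ j → ballot j L) s + (t * p₃ + p₄ + q₃)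
    closing = begin
      antidiag (λ i j → completions (t + i) j L) s
        ≡⟨ antidiag-cong s (λ i j eq → trans (completions-announced L (t + i) j)
             (cong (λ k → δ (t + i) * ballot j L + ((t + i) * binomialTransform j (λ j → G₁ j k L) + binomialTransform j (λ j → G₀ j k L)))
                   (total i j eq))) ⟩
      antidiag (λ i j → δ (t + i) * ballot j L + ((t + i) * binomialTransform j g₁ + binomialTransform j g₀)) s
        ≡⟨ antidiag-+ (λ i j → δ (t + i) * ballot j L) _ s ⟩
      antidiag (λ i j → δ (t + i) * ballot j L) s + antidiag (λ i j → (t + i) * binomialTransform j g₁ + binomialTransform j g₀) s
        ≡⟨ cong₂ _+_ (ballots t s) (trans (antidiag-+ (λ i j → (t + i) * binomialTransform j g₁) _ s)
             (cong₂ _+_ (antidiag-weighted-binomialTransform g₁ t s) (antidiag-binomialTransform g₀ s))) ⟩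
      d * shift (λ j → ballot j L) s + (t * p₃ + p₄ + q₃) ∎
      where
      g₁ g₀ : ℕ → ℕ
      g₁ j = G₁ j (pred K) L
      g₀ j = G₀ j (pred K) L

  -- Σ over m and q of R m * ((m + q) C q) * S (k + q) (L − 1 − m − q): m letters
  -- shuffled with q openings, followed by the letter that completes σ.
  shuffled : (ℕ → ℕ) → ℕ → ℕ → ℕ
  shuffled R k zero    = 0
  shuffled R k (suc L) = R 0 * S k L + shuffled (R ∘ suc) k L + shuffled R (suc k) L

  shuffled-+ : ∀ R R′ k L → shuffled (λ m → R m + R′ m) k L ≡ shuffled R k L + shuffled R′ k L
  shuffled-+ R R′ k zero    = refl
  shuffled-+ R R′ k (suc L)
    rewrite shuffled-+ (R ∘ suc) (R′ ∘ suc) k L | shuffled-+ R R′ (suc k) L =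
    r (R 0) (R′ 0) (S k L) (shuffled (R ∘ suc) k L) _ (shuffled R (suc k) L) _
    where
    r : ∀ a b x c d e f → (a + b) * x + (c + d) + (e + f) ≡ (a * x + c + e) + (b * x + d + f)
    r = solve-∀

  shuffled-0 : ∀ k L → shuffled (λ _ → 0) k L ≡ 0
  shuffled-0 k zero    = refl
  shuffled-0 k (suc L) = cong₂ _+_ (shuffled-0 k L) (shuffled-0 (suc k) L)

  -- The `suc` is the completing edge, so `k` counts the open edges that stay open. Their openings
  -- do not change `s`, and no other letter before the completing one changes `k`; hence the two
  -- kinds of letters interleave freely.
  G₁-shuffled : ∀ L s k → G₁ s (suc (s + k)) L ≡ shuffled (ballot s) k L
  G₁-shuffled zero    s k = refl
  G₁-shuffled (suc L) s k = begin
    G₁ s (suc (suc (s + k))) L + G₁ (suc s) (suc (suc s + k)) L + down + δ s * S (s + k) L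
      ≡⟨ cong₂ _+_ (cong₂ _+_ (cong₂ _+_
           (trans (cong (λ x → G₁ s (suc x) L) (sym (+-suc s k))) (G₁-shuffled L s (suc k)))
           (G₁-shuffled L (suc s) k)) (downs s)) (final s) ⟩
    h + u + shuffled (λ m → shift (λ j → ballot j m) s) k L + δ s * S k L
      ≡⟨ r h u _ (δ s * S k L) ⟩
    δ s * S k L + (u + shuffled (λ m → shift (λ j → ballot j m) s) k L) + h
      ≡⟨ cong (λ x → δ s * S k L + x + h) (shuffled-+ (ballot (suc s)) _ k L) ⟨
    shuffled (ballot s) k (suc L) ∎
    where
    h u down : ℕ
    h = shuffled (ballot s) (suc k) L
    u = shuffled (ballot (suc s)) k L
    down = shift (λ j → G₁ j (s + k) L) s
    downs : ∀ s → shift (λ j → G₁ j (s + k) L) s ≡ shuffled (λ m → shift (λ j → ballot j m) s) k L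
    downs zero    = sym (shuffled-0 k L)
    downs (suc s) = G₁-shuffled L s k
    final : ∀ s → δ s * S (s + k) L ≡ δ s * S k L
    final zero    = refl
    final (suc s) = refl
    r : ∀ h u v x → h + u + v + x ≡ x + (u + v) + h
    r = solve-∀

  -- No `suc` here: the completing edge is still one of the `s` announced ones, or not yet opened.
  G₀-shuffled : ∀ L s k → G₀ s (s + k) L ≡ shuffled (ballot₂ s) k L
  G₀-shuffled zero    s k = refl
  G₀-shuffled (suc L) s k = begin
    G₀ s (suc (s + k)) L + G₀ (suc s) (suc s + k) L + shift (λ j → G₀ j (pred (s + k)) L) s
      + shift (shift (λ j → G₁ j (pred (s + k)) L)) s
      ≡⟨ cong₂ _+_ (cong₂ _+_ (cong₂ _+_
           (trans (cong (λ x → G₀ s x L) (sym (+-suc s k))) (G₀-shuffled L s (suc k)))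
           (G₀-shuffled L (suc s) k)) (downs s)) (specials s) ⟩
    h + u + v + w
      ≡⟨ r h u v w ⟩
    u + v + w + h
      ≡⟨ cong (λ x → x + w + h) (shuffled-+ (ballot₂ (suc s)) _ k L) ⟨
    shuffled (λ m → ballot₂ (suc s) m + shift (λ j → ballot₂ j m) s) k L + w + h
      ≡⟨ cong (_+ h) (shuffled-+ (λ m → ballot₂ (suc s) m + shift (λ j → ballot₂ j m) s) _ k L) ⟨
    shuffled (ballot₂ s) k (suc L) ∎
    where
    h u v w : ℕ
    h = shuffled (ballot₂ s) (suc k) L
    u = shuffled (ballot₂ (suc s)) k L
    v = shuffled (λ m → shift (λ j → ballot₂ j m) s) k L
    w = shuffled (λ m → shift (shift (λ j → ballot j m)) s) k L
    downs : ∀ s → shift (λ j → G₀ j (pred (s + k)) L) s ≡ shuffled (λ m → shift (λ j → ballot₂ j m) s) k L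
    downs zero    = sym (shuffled-0 k L)
    downs (suc s) = G₀-shuffled L s k
    -- Two edges leave the announced ones but only one is closed; the other is the additional open
    -- edge in `G₁-shuffled`.
    specials : ∀ s → shift (shift (λ j → G₁ j (pred (s + k)) L)) s ≡
      shuffled (λ m → shift (shift (λ j → ballot j m)) s) k L
    specials zero          = sym (shuffled-0 k L)
    specials (suc zero)    = sym (shuffled-0 k L)
    specials (suc (suc s)) = G₁-shuffled L s k
    r : ∀ h u v w → h + u + v + w ≡ u + v + w + h
    r = solve-∀

  -- S k (L − 1 − r), and 0 if L ≤ r.
  remainder : ℕ → ℕ → ℕ → ℕ
  remainder k zero    r       = 0
  remainder k (suc L) zero    = S k L
  remainder k (suc L) (suc r) = remainder k L r

  -- Both bounds are free because each recursive call shortens only one of the two ranges. The grid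
  -- splits into a corner, two sides and the interior, where Pascal's rule joins the shuffles
  -- starting with either kind of letter.
  shuffled-sum : ∀ L R k N₁ N₂ → L ≤ N₁ → L ≤ N₂ → shuffled R k L ≡
    sumTo N₁ (λ m → sumTo N₂ (λ q → R m * ((m + q) C q) * remainder (k + q) L (m + q)))
  shuffled-sum zero    R k N₁ N₂ _ _ = sym (sumTo-0 N₁ λ m → sumTo-0 N₂ λ q → *-zeroʳ (R m * ((m + q) C q)))
  shuffled-sum (suc L) R k (suc a) (suc b) (s≤s L≤a) (s≤s L≤b) = begin
    R 0 * S k L + shuffled (R ∘ suc) k L + shuffled R (suc k) L
      ≡⟨ cong₂ (λ x y → R 0 * S k L + x + y)
           (trans (shuffled-sum L (R ∘ suc) k a (suc b) L≤a (m≤n⇒m≤1+n L≤b)) (sumTo-+ a edge _))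
           (shuffled-sum L R (suc k) (suc a) b (m≤n⇒m≤1+n L≤a) L≤b) ⟩
    R 0 * S k L + (sumTo a edge + sumTo a (λ m → sumTo b (x m)))
      + (sumTo b (λ q → R 0 * ((0 + q) C q) * remainder (suc k + q) L (0 + q)) + sumTo a (λ m → sumTo b (y m)))
      ≡⟨ r (R 0 * S k L) (sumTo a edge) _ _ _ ⟩
    R 0 * S k L + sumTo b (λ q → R 0 * ((0 + q) C q) * remainder (suc k + q) L (0 + q))
      + (sumTo a edge + (sumTo a (λ m → sumTo b (x m)) + sumTo a (λ m → sumTo b (y m))))
      ≡⟨ cong₂ _+_ (cong₂ _+_ corner (sumTo-cong b λ q _ → side q)) (cong (sumTo a edge +_) interior) ⟩
    R 0 * 1 * remainder (k + 0) (suc L) 0 + sumTo b (λ q → R 0 * ((0 + suc q) C suc q) * remainder (k + suc q) (suc L) (0 + suc q))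
      + (sumTo a edge + sumTo a (λ m → sumTo b (z m)))
      ≡⟨ cong (_ +_) (sumTo-+ a edge _) ⟨
    _ ∎
    where
    edge : ℕ → ℕ
    edge m = R (suc m) * ((m + 0) C 0) * remainder (k + 0) L (m + 0)
    x y z : ℕ → ℕ → ℕ
    x m q = R (suc m) * ((m + suc q) C suc q) * remainder (k + suc q) L (m + suc q)
    y m q = R (suc m) * ((suc m + q) C q) * remainder (suc k + q) L (suc m + q)
    z m q = R (suc m) * ((suc m + suc q) C suc q) * remainder (k + suc q) L (m + suc q)
    corner : R 0 * S k L ≡ R 0 * 1 * S (k + 0) L
    corner = cong₂ _*_ (sym (*-identityʳ (R 0))) (cong (λ x → S x L) (sym (+-identityʳ k)))
    side : ∀ q → R 0 * (q C q) * remainder (suc k + q) L q ≡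
      R 0 * (suc q C suc q) * remainder (k + suc q) L q
    side q = cong₂ (λ u v → R 0 * u * remainder v L q) (trans (nCn≡1 q) (sym (nCn≡1 (suc q)))) (sym (+-suc k q))
    pascal : ∀ m q → x m q + y m q ≡ z m q
    pascal m q = begin
      x m q + y m q
        ≡⟨ cong (x m q +_) (cong₂ (λ u v → R (suc m) * (u C q) * remainder v L u) (sym (+-suc m q)) (sym (+-suc k q))) ⟩
      R (suc m) * (c C suc q) * w + R (suc m) * (c C q) * w
        ≡⟨ r′ (R (suc m)) (c C suc q) (c C q) w ⟩
      R (suc m) * (c C q + c C suc q) * w
        ≡⟨ cong (λ u → R (suc m) * u * w) (nCk+nC[k+1]≡[n+1]C[k+1] c q) ⟩
      z m q ∎
      where
      c w : ℕ
      c = m + suc q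
      w = remainder (k + suc q) L c
      r′ : ∀ a u v w → a * u * w + a * v * w ≡ a * (v + u) * w
      r′ = solve-∀
    interior : sumTo a (λ m → sumTo b (x m)) + sumTo a (λ m → sumTo b (y m)) ≡ sumTo a (λ m → sumTo b (z m))
    interior = trans (sym (sumTo-+ a _ _)) (sumTo-cong a λ m _ →
      trans (sym (sumTo-+ b (x m) (y m))) (sumTo-cong b λ q _ → pascal m q))
    r : ∀ p e x s y → p + (e + x) + (s + y) ≡ p + s + (e + (x + y))
    r = solve-∀

  remainder-+ : ∀ k c L r → remainder k (c + L) (c + r) ≡ remainder k L r
  remainder-+ k zero    L r = refl
  remainder-+ k (suc c) L r = remainder-+ k c L r

  remainder-≤ : ∀ k L r → r ≤ L → remainder k (suc L) r ≡ S k (L ∸ r)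
  remainder-≤ k L       zero    _ = refl
  remainder-≤ k (suc L) (suc r) p = remainder-≤ k L r (s≤s⁻¹ p)

  remainder-> : ∀ k L r → L ≤ r → remainder k L r ≡ 0
  remainder-> k zero    r       _ = refl
  remainder-> k (suc L) (suc r) p = remainder-> k L r (s≤s⁻¹ p)

-- From the recursion to the double sum

catalan-ballot : ∀ n → catalan n ≡ ballot 0 (n + n)
catalan-ballot n = begin
  ((2 * n) C n) / suc n          ≡⟨ cong (λ x → ((n + x) C n) / suc n) (+-identityʳ n) ⟩
  ((n + n) C n) / suc n          ≡⟨ /-congˡ {o = suc n} (ballot-central n) ⟨
  (ballot 0 (n + n) * suc n) / suc n ≡⟨ m*n/n≡m (ballot 0 (n + n)) (suc n) ⟩
  ballot 0 (n + n)               ∎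

module _ (M : ℕ → ℕ) where

  -- `M` takes a number of letters, not an order. The truncated `L ∸ h` is harmless: for `L < h` the
  -- binomial coefficient is 0.
  suffixes : ℕ → ℕ → ℕ
  suffixes h L = (L C h) * h ! * M (L ∸ h)

  open Counting suffixes

  -- The index `m` is the length of the path and `q` the number of openings shuffled in. Even `m`
  -- contribute nothing, `m = 2ℓ − 1` gives the summand for ℓ, and `q` becomes k.
  completions-formula : ∀ (M₂ : ℕ → ℕ) → (∀ j → M (j * 2) ≡ M₂ j) → ∀ n → 2 ≤ n → completions 0 0 (n * 2) ≡ catalan n +
    ∑ 2 n (λ ℓ → ∑ 0 (n ∸ ℓ) (λ k →
      ((2 * ℓ ∸ 1) C (ℓ ∸ 2)) * ((2 * ℓ ∸ 1 + k) C k) * ((2 * (n ∸ ℓ) ∸ k) C k) * (k !) * M₂ (n ∸ ℓ ∸ k)))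
  completions-formula M₂ M≡M₂ (suc (suc n)) (s≤s (s≤s z≤n)) = begin
    completions 0 0 (N * 2)               ≡⟨ cong (completions 0 0) (double N) ⟩
    completions 0 0 (N + N)               ≡⟨ completions-announced (N + N) 0 0 ⟩
    1 * ballot 0 (N + N) + G₀ 0 0 (N + N) ≡⟨ cong₂ _+_ (trans (*-identityˡ _) (sym (catalan-ballot N))) (G₀-shuffled (N + N) 0 0) ⟩
    catalan N + shuffled (ballot₂ 0) 0 (N + N)
      ≡⟨ cong (catalan N +_) (shuffled-sum (N + N) (ballot₂ 0) 0 (N + N) (N + N) ≤-refl ≤-refl) ⟩
    catalan N + sumTo (N + N) row
      ≡⟨ cong (catalan N +_) (sumTo-odd N {row} λ i → sumTo-0 (N + N) λ q →
           cong (λ x → x * ((i + i + q) C q) * remainder q (N + N) (i + i + q)) (ballot₂-even i)) ⟩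
    catalan N + sumTo N (λ i → row (suc (i + i)))
      -- The row for path length 1 is 0, as a path with a step -2 needs three steps; hence ℓ starts
      -- at 2.
      ≡⟨ cong (λ x → catalan N + (x + sumTo (suc n) (λ i → row (suc (suc i + suc i))))) (sumTo-0 (N + N) λ _ → refl) ⟩
    catalan N + sumTo (suc n) (λ i → row (suc (suc i + suc i)))
      ≡⟨ cong (catalan N +_) (sumTo-cong (suc n) λ i i<1+n → rows i (s≤s⁻¹ i<1+n)) ⟩
    _ ∎
    where
    N : ℕ
    N = suc (suc n)
    double : ∀ n → n * 2 ≡ n + n
    double n = trans (*-comm n 2) (cong (n +_) (+-identityʳ n))
    cell : ℕ → ℕ → ℕ
    cell m q = ballot₂ 0 m * ((m + q) C q) * remainder q (N + N) (m + q)
    row : ℕ → ℕ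
    row m = sumTo (N + N) (cell m)
    rows : ∀ i → i ≤ n → row (suc (suc i + suc i)) ≡ ∑ 0 (N ∸ (2 + i)) (λ k →
      ((2 * (2 + i) ∸ 1) C i) * ((2 * (2 + i) ∸ 1 + k) C k) * ((2 * (N ∸ (2 + i)) ∸ k) C k) * (k !) * M₂ (N ∸ (2 + i) ∸ k))
    rows i i≤n = trans (sumTo-truncate (suc d) (N + N) d<N+N outside) (sumTo-cong (suc d) λ q q<1+d → inside q (s≤s⁻¹ q<1+d))
      where
      d m : ℕ
      d = n ∸ i
      m = suc (suc i + suc i)
      d<N+N : suc d ≤ N + N
      d<N+N = ≤-trans (s≤s (≤-trans (m∸n≤m n i) (n≤1+n n))) (m≤m+n N N)
      m≡ : 2 * (2 + i) ∸ 1 ≡ m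
      m≡ = trans (cong (λ x → suc (i + suc (suc x))) (+-identityʳ i)) (cong suc (+-suc i (suc i)))
      N+N≡ : N + N ≡ m + suc (d + d)
      N+N≡ = trans (cong (λ x → 2 + x + (2 + x)) (sym (m+[n∸m]≡n i≤n))) (r i d)
        where
        r : ∀ i d → 2 + (i + d) + (2 + (i + d)) ≡ 1 + (1 + i + (1 + i)) + (1 + (d + d))
        r = solve-∀
      rem : ∀ q → remainder q (N + N) (m + q) ≡ remainder q (suc (d + d)) q
      rem q = trans (cong (λ x → remainder q x (m + q)) N+N≡) (remainder-+ q m (suc (d + d)) q)
      -- For `q > d` the `2d − q` remaining letters are too few for `q` right ends.
      outside : ∀ q → suc d ≤ q → cell m q ≡ 0
      outside q d<q = trans (cong (ballot₂ 0 m * ((m + q) C q) *_) (trans (rem q) zeros)) (*-zeroʳ (ballot₂ 0 m * ((m + q) C q)))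
        where
        zeros : remainder q (suc (d + d)) q ≡ 0
        zeros with q ≤? d + d
        ... | no  q≰2d = remainder-> q (suc (d + d)) q (≰⇒> q≰2d)
        ... | yes q≤2d = trans (remainder-≤ q (d + d) q q≤2d)
          (cong (λ x → x * q ! * M (d + d ∸ q ∸ q)) (k>n⇒nCk≡0
            (≤-<-trans (≤-trans (∸-monoʳ-≤ (d + d) (<⇒≤ d<q)) (≤-reflexive (m+n∸n≡m d d))) d<q)))
      inside : ∀ q → q ≤ d → cell m q ≡
        ((2 * (2 + i) ∸ 1) C i) * ((2 * (2 + i) ∸ 1 + q) C q) * ((2 * d ∸ q) C q) * (q !) * M₂ (d ∸ q)
      inside q q≤d = begin
        ballot₂ 0 m * ((m + q) C q) * remainder q (N + N) (m + q)
          ≡⟨ cong₂ (λ x y → x * ((m + q) C q) * y) (ballot₂-closed i)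
               (trans (rem q) (remainder-≤ q (d + d) q (≤-trans q≤d (m≤m+n d d)))) ⟩
        (m C i) * ((m + q) C q) * (((d + d ∸ q) C q) * q ! * M (d + d ∸ q ∸ q))
          ≡⟨ r ((m C i) * ((m + q) C q)) ((d + d ∸ q) C q) (q !) _ ⟩
        (m C i) * ((m + q) C q) * ((d + d ∸ q) C q) * q ! * M (d + d ∸ q ∸ q)
          ≡⟨ cong₂ _*_ (cong₂ (λ x y → (x C i) * ((x + q) C q) * ((d + y ∸ q) C q) * q !) (sym m≡) (sym (+-identityʳ d)))
               (trans (cong M (trans (∸-+-assoc (d + d) q q) (trans (cong₂ _∸_ (sym (double d)) (sym (double q))) (sym (*-distribʳ-∸ 2 d q))))) (M≡M₂ (d ∸ q))) ⟩
        _ ∎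
        where
        r : ∀ a b c d → a * (b * c * d) ≡ a * b * c * d
        r = solve-∀

private variable
  A B : Set
  m n L f : ℕ
  e p w : List ℕ

-- Sums over lists

sumOver : (A → ℕ) → List A → ℕ
sumOver g xs = sum (map g xs)

sumOver-++ : ∀ (g : A → ℕ) xs ys → sumOver g (xs ++ ys) ≡ sumOver g xs + sumOver g ys
sumOver-++ g xs ys = trans (cong sum (map-++ g xs ys)) (sum-++ (map g xs) (map g ys))

sumOver-map : ∀ (g : B → ℕ) (h : A → B) xs → sumOver g (map h xs) ≡ sumOver (g ∘ h) xs
sumOver-map g h xs = cong sum (sym (map-∘ xs))

sumOver-concatMap : ∀ (g : B → ℕ) (h : A → List B) xs →
  sumOver g (concatMap h xs) ≡ sumOver (sumOver g ∘ h) xs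
sumOver-concatMap g h []       = refl
sumOver-concatMap g h (x ∷ xs) =
  trans (sumOver-++ g (h x) (concatMap h xs)) (cong (sumOver g (h x) +_) (sumOver-concatMap g h xs))

sumOver-cong : ∀ {g h : A → ℕ} xs → (∀ {x} → x ∈ xs → g x ≡ h x) → sumOver g xs ≡ sumOver h xs
sumOver-cong []       eq = refl
sumOver-cong (x ∷ xs) eq = cong₂ _+_ (eq (here refl)) (sumOver-cong xs (eq ∘ there))

sumOver-*ˡ : ∀ c (g : A → ℕ) xs → sumOver (λ x → c * g x) xs ≡ c * sumOver g xs
sumOver-*ˡ c g []       = sym (*-zeroʳ c)
sumOver-*ˡ c g (x ∷ xs) = trans (cong (c * g x +_) (sumOver-*ˡ c g xs)) (sym (*-distribˡ-+ c (g x) _))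

sumOver-const : ∀ c (xs : List A) → sumOver (λ _ → c) xs ≡ length xs * c
sumOver-const c []       = refl
sumOver-const c (x ∷ xs) = cong (c +_) (sumOver-const c xs)

indicator : Bool → ℕ
indicator true  = 1
indicator false = 0

splits : List A → List (List A × A × List A)
splits []       = []
splits (x ∷ xs) = ([] , x , xs) ∷ map (λ (pre , y , post) → x ∷ pre , y , post) (splits xs)

splits-∈⁺ : ∀ (pre : List A) x post → (pre , x , post) ∈ splits (pre ++ x ∷ post)
splits-∈⁺ []        x post = here refl
splits-∈⁺ (y ∷ pre) x post = there (∈-map⁺ _ (splits-∈⁺ pre x post))

splits-∈⁻ : ∀ (xs : List A) {pre x post} → (pre , x , post) ∈ splits xs → xs ≡ pre ++ x ∷ post
splits-∈⁻ (y ∷ xs) (here refl) = refl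
splits-∈⁻ (y ∷ xs) (there s∈) with _ , s′∈ , refl ← ∈-map⁻ _ s∈ = cong (y ∷_) (splits-∈⁻ xs s′∈)

sumOver-splits-∷ : ∀ (g : List A × A × List A → ℕ) x xs → sumOver g (splits (x ∷ xs)) ≡
  g ([] , x , xs) + sumOver (λ (pre , y , post) → g (x ∷ pre , y , post)) (splits xs)
sumOver-splits-∷ g x xs = cong (g ([] , x , xs) +_) (sumOver-map g _ (splits xs))

sumOver-splits-++ : ∀ (g : List A × A × List A → ℕ) xs ys → sumOver g (splits (xs ++ ys)) ≡
  sumOver (λ (pre , y , post) → g (pre , y , post ++ ys)) (splits xs) +
  sumOver (λ (pre , y , post) → g (xs ++ pre , y , post)) (splits ys)
sumOver-splits-++ g []       ys = refl
sumOver-splits-++ g (x ∷ xs) ys = begin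
  sumOver g (splits (x ∷ xs ++ ys))
    ≡⟨ sumOver-splits-∷ g x (xs ++ ys) ⟩
  g₀ + sumOver (λ (pre , y , post) → g (x ∷ pre , y , post)) (splits (xs ++ ys))
    ≡⟨ cong (g₀ +_) (sumOver-splits-++ (λ (pre , y , post) → g (x ∷ pre , y , post)) xs ys) ⟩
  g₀ + (sumOver (λ (pre , y , post) → g (x ∷ pre , y , post ++ ys)) (splits xs) + rest)
    ≡⟨ +-assoc g₀ _ rest ⟨
  g₀ + sumOver (λ (pre , y , post) → g (x ∷ pre , y , post ++ ys)) (splits xs) + rest
    ≡⟨ cong (_+ rest) (sumOver-splits-∷ (λ (pre , y , post) → g (pre , y , post ++ ys)) x xs) ⟨
  sumOver (λ (pre , y , post) → g (pre , y , post ++ ys)) (splits (x ∷ xs)) + rest ∎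
  where
  g₀ rest : ℕ
  g₀   = g ([] , x , xs ++ ys)
  rest = sumOver (λ (pre , y , post) → g (x ∷ xs ++ pre , y , post)) (splits ys)

length-splits : ∀ (xs : List A) → length (splits xs) ≡ length xs
length-splits []       = refl
length-splits (x ∷ xs) = cong suc (trans (length-map _ (splits xs)) (length-splits xs))

module _ {Q : A → Set} (Q? : ∀ x → Dec (Q x)) where

  satisfying failing : List A → ℕ
  satisfying = sumOver (λ x → indicator (does (Q? x)))
  failing    = sumOver (λ x → indicator (not (does (Q? x))))

  satisfying+failing : ∀ xs → satisfying xs + failing xs ≡ length xs
  satisfying+failing []       = refl
  satisfying+failing (x ∷ xs) with Q? x
  ... | yes _ = cong suc (satisfying+failing xs)
  ... | no  _ = trans (+-suc _ _) (cong suc (satisfying+failing xs))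

  -- As `x` runs through the failing elements, the numbers of failing elements before and after it
  -- run through the index pairs of `antidiag`. With "dangerous" as the property, this is the
  -- closing part of `completions`.
  sumOver-splits-failing : ∀ c (F : ℕ → ℕ → ℕ) xs →
    sumOver (λ (pre , x , post) → if does (Q? x) then c else F (failing pre) (failing post)) (splits xs) ≡
    satisfying xs * c + antidiag F (failing xs)
  sumOver-splits-failing c F []       = refl
  sumOver-splits-failing c F (x ∷ xs) = trans (sumOver-splits-∷ _ x xs) (step x)
    where
    step : ∀ x →
      (if does (Q? x) then c else F 0 (failing xs)) +
      sumOver (λ (pre , y , post) → if does (Q? y) then c else F (failing (x ∷ pre)) (failing post)) (splits xs)
      ≡ satisfying (x ∷ xs) * c + antidiag F (failing (x ∷ xs))
    step x with Q? x
    ... | yes _ = trans (cong (c +_) (sumOver-splits-failing c F xs)) (sym (+-assoc c _ _))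
    ... | no  _ = trans (cong (F 0 (failing xs) +_) (sumOver-splits-failing c (F ∘ suc) xs)) (swap (F 0 (failing xs)) (satisfying xs * c) _)
      where
      swap : ∀ a b c → a + (b + c) ≡ b + (a + c)
      swap = solve-∀

-- Sublists and occurrences of patterns

⊆-snoc⁻ : ∀ u {y x : A} p → u ++ [ y ] ⊆ p ++ [ x ] → u ++ [ y ] ⊆ p ⊎ (y ≡ x × u ⊆ p)
⊆-snoc⁻ []      []      (refl ∷ _)  = inj₂ (refl , [])
⊆-snoc⁻ []      []      (_ ∷ʳ s)    = inj₁ s
⊆-snoc⁻ (_ ∷ []) []     (_ ∷ ())
⊆-snoc⁻ (_ ∷ _ ∷ _) []  (_ ∷ ())
⊆-snoc⁻ (_ ∷ _) []      (_ ∷ʳ ())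
⊆-snoc⁻ u       (a ∷ p) (_ ∷ʳ s)    = Sum.map (a ∷ʳ_) (λ (eq , s′) → eq , a ∷ʳ s′) (⊆-snoc⁻ u p s)
⊆-snoc⁻ []      (a ∷ p) (refl ∷ s)  = inj₁ (refl ∷ minimum p)
⊆-snoc⁻ (b ∷ u) (a ∷ p) (refl ∷ s)  = Sum.map (refl ∷_) (λ (eq , s′) → eq , refl ∷ s′) (⊆-snoc⁻ u p s)

⊆-snoc : ∀ {x : A} {p q} → p ⊆ q → p ++ [ x ] ⊆ q ++ [ x ]
⊆-snoc s = ++⁺ s ⊆-refl

-- If `u` does not fit into `p`, its last letter sits at `x` or beyond, and all of `v` comes after
-- it.
⊆-++⁻ : ∀ u {v : List A} p {x r} → u ++ v ⊆ p ++ x ∷ r → u ⊆ p ⊎ v ⊆ r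
⊆-++⁻ []      p       s          = inj₁ (minimum p)
⊆-++⁻ (a ∷ u) []      (_ ∷ʳ s)   = inj₂ (⊆-trans (++⁺ˡ (a ∷ u) ⊆-refl) s)
⊆-++⁻ (a ∷ u) []      (_ ∷ s)    = inj₂ (⊆-trans (++⁺ˡ u ⊆-refl) s)
⊆-++⁻ u       (b ∷ p) (_ ∷ʳ s)   = Sum.map₁ (b ∷ʳ_) (⊆-++⁻ u p s)
⊆-++⁻ (a ∷ u) (b ∷ p) (refl ∷ s) = Sum.map₁ (refl ∷_) (⊆-++⁻ u p s)

-- An occurrence of v in w is encoded by the list of pairs (letter of w , letter of v).
Consistent : List (ℕ × ℕ) → Set
Consistent z = ∀ {c d} → c ∈ z → d ∈ z → proj₁ c ≡ proj₁ d ⇔ proj₂ c ≡ proj₂ d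

Occurs : List ℕ → List ℕ → Set
Occurs v w = ∃ λ z → map proj₂ z ≡ v × map proj₁ z ⊆ w × Consistent z

consistent? : ∀ z → Dec (Consistent z)
consistent? z = map′ (λ a c∈ d∈ → All.lookup (All.lookup a c∈) d∈)
  (λ c → All.tabulate λ c∈ → All.tabulate λ d∈ → c c∈ d∈)
  (All.all? (λ c → All.all? (λ d → (proj₁ c ≟ proj₁ d) ⇔-dec (proj₂ c ≟ proj₂ d)) z) z)

-- The predicate is arbitrary because consistency of a list is more than consistency of its tail:
-- each chosen pair is absorbed into the predicate for the rest.
pairing? : ∀ v w {Q : List (ℕ × ℕ) → Set} → (∀ z → Dec (Q z)) →
  Dec (∃ λ z → map proj₂ z ≡ v × map proj₁ z ⊆ w × Q z)
pairing? []      w       Q? = map′ (λ q → [] , refl , minimum w , q) (λ { ([] , _ , _ , q) → q }) (Q? [])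
pairing? (b ∷ v) []      Q? = no λ { ([] , () , _) ; (_ ∷ _ , _ , () , _) }
pairing? (b ∷ v) (a ∷ w) Q? = map′
  [ (λ (z , eq , s , q) → (a , b) ∷ z , cong (b ∷_) eq , refl ∷ s , q)
  , (λ (z , eq , s , q) → z , eq , a ∷ʳ s , q) ]′
  (λ { (c ∷ z , eq , _ ∷ʳ s , q) → inj₂ (c ∷ z , eq , s , q)
     ; (_ ∷ z , refl , refl ∷ s , q) → inj₁ (z , refl , s , q) })
  (pairing? v w (Q? ∘ ((a , b) ∷_)) ⊎-dec pairing? (b ∷ v) w Q?)

occurs? : ∀ v w → Dec (Occurs v w)
occurs? v w = pairing? v w consistent?

Occurs-⊆ : ∀ {v w w′} → w ⊆ w′ → Occurs v w → Occurs v w′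
Occurs-⊆ s (z , eq , s′ , c) = z , eq , ⊆-trans s′ s , c

Consistent-⊆ : ∀ {z z′} → z ⊆ z′ → Consistent z′ → Consistent z
Consistent-⊆ s con c∈ d∈ = con (lookup s c∈) (lookup s d∈)

map-++⁻ : ∀ (g : A → B) z u {v} → map g z ≡ u ++ v →
  ∃₂ λ z₁ z₂ → z ≡ z₁ ++ z₂ × map g z₁ ≡ u × map g z₂ ≡ v
map-++⁻ g z       []      eq = [] , z , refl , refl , eq
map-++⁻ g (x ∷ z) (y ∷ u) eq with ∷-injective eq
... | refl , eq′ with map-++⁻ g z u eq′
...   | z₁ , z₂ , refl , refl , refl = x ∷ z₁ , z₂ , refl , refl , refl

relabel-pattern : ∀ {g : ℕ → ℕ} → (∀ {a b} → g a ≡ g b → a ≡ b) → ∀ {v w} →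
  Occurs (map g v) w ⇔ Occurs v w
relabel-pattern {g} inj {v} {w} = mk⇔ back forth
  where
  forth : Occurs v w → Occurs (map g v) w
  forth (z , refl , s , con) = map (λ (a , b) → a , g b) z ,
    trans (sym (map-∘ z)) (map-∘ z) , subst (_⊆ w) (map-∘ z) s ,
    λ c∈ d∈ → relate (∈-map⁻ _ c∈) (∈-map⁻ _ d∈)
    where
    relate : ∀ {c d} → (∃ λ c′ → c′ ∈ z × c ≡ (proj₁ c′ , g (proj₂ c′))) →
      (∃ λ d′ → d′ ∈ z × d ≡ (proj₁ d′ , g (proj₂ d′))) → proj₁ c ≡ proj₁ d ⇔ proj₂ c ≡ proj₂ d
    relate (c , c∈ , refl) (d , d∈ , refl) =
      mk⇔ (cong g ∘ to (con c∈ d∈)) (from (con c∈ d∈) ∘ inj)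
  unlabel : ∀ v (z : List (ℕ × ℕ)) → map proj₂ z ≡ map g v →
    ∃ λ z′ → map proj₂ z′ ≡ v × z ≡ map (λ (a , b) → a , g b) z′
  unlabel []      []            eq = [] , refl , refl
  unlabel (b ∷ v) ((a , _) ∷ z) eq with ∷-injective eq
  ... | refl , eq′ with unlabel v z eq′
  ...   | z′ , refl , refl = (a , b) ∷ z′ , refl , refl
  back : Occurs (map g v) w → Occurs v w
  back (z , eq , s , con) with unlabel v z eq
  ... | z′ , refl , refl = z′ , refl , subst (_⊆ w) (sym (map-∘ z′)) s ,
    λ c∈ d∈ → mk⇔ (inj ∘ to (con (∈-map⁺ _ c∈) (∈-map⁺ _ d∈))) (from (con (∈-map⁺ _ c∈) (∈-map⁺ _ d∈)) ∘ cong g)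

relabel-word : ∀ {g : ℕ → ℕ} → (∀ {a b} → g a ≡ g b → a ≡ b) → ∀ {v w} →
  Occurs v (map g w) ⇔ Occurs v w
relabel-word {g} inj {v} {w} = mk⇔ back forth
  where
  forth : Occurs v w → Occurs v (map g w)
  forth (z , refl , s , con) = map (λ (a , b) → g a , b) z , sym (map-∘ z) ,
    subst (_⊆ map g w) (trans (sym (map-∘ z)) (map-∘ z)) (Sublist.map⁺ g s) ,
    λ c∈ d∈ → relate (∈-map⁻ _ c∈) (∈-map⁻ _ d∈)
    where
    relate : ∀ {c d} → (∃ λ c′ → c′ ∈ z × c ≡ (g (proj₁ c′) , proj₂ c′)) →
      (∃ λ d′ → d′ ∈ z × d ≡ (g (proj₁ d′) , proj₂ d′)) → proj₁ c ≡ proj₁ d ⇔ proj₂ c ≡ proj₂ d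
    relate (c , c∈ , refl) (d , d∈ , refl) =
      mk⇔ (to (con c∈ d∈) ∘ inj) (cong g ∘ from (con c∈ d∈))
  unlabel : ∀ w (z : List (ℕ × ℕ)) → map proj₁ z ⊆ map g w →
    ∃ λ z′ → map proj₁ z′ ⊆ w × z ≡ map (λ (a , b) → g a , b) z′
  unlabel w       []            s = [] , minimum w , refl
  unlabel (a ∷ w) z@(_ ∷ _)     (_ ∷ʳ s) with unlabel w z s
  ... | z′ , s′ , eq = z′ , a ∷ʳ s′ , eq
  unlabel (a ∷ w) ((_ , b) ∷ z) (refl ∷ s) with unlabel w z s
  ... | z′ , s′ , refl = (a , b) ∷ z′ , refl ∷ s′ , refl
  back : Occurs v (map g w) → Occurs v w
  back (z , eq , s , con) with unlabel w z s
  ... | z′ , s′ , refl = z′ , trans (map-∘ z′) eq , s′ ,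
    λ c∈ d∈ → mk⇔ (to (con (∈-map⁺ _ c∈) (∈-map⁺ _ d∈)) ∘ cong g) (inj ∘ from (con (∈-map⁺ _ c∈) (∈-map⁺ _ d∈)))

-- The property of matchings that confines occurrences: a letter that a word contains only once
-- cannot take part in an occurrence of a doubled pattern there.
Doubled : List ℕ → Set
Doubled v = ∀ {a} → a ∈ v → a ∷ a ∷ [] ⊆ v

⊆-map⁻ : ∀ (g : A → B) u z → u ⊆ map g z → ∃ λ z′ → z′ ⊆ z × map g z′ ≡ u
⊆-map⁻ g .[] []      []       = [] , [] , refl
⊆-map⁻ g u   (x ∷ z) (_ ∷ʳ s) with ⊆-map⁻ g u z s
... | z′ , s′ , eq = z′ , x ∷ʳ s′ , eq
⊆-map⁻ g _   (x ∷ z) (refl ∷ s) with ⊆-map⁻ g _ z s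
... | z′ , s′ , eq = x ∷ z′ , refl ∷ s′ , cong (g x ∷_) eq

Doubled-occurrence : ∀ {z} → Consistent z → Doubled (map proj₂ z) → Doubled (map proj₁ z)
Doubled-occurrence {z} con dbl a∈ with ∈-map⁻ proj₁ a∈
... | (x , a) , c∈ , refl with ⊆-map⁻ proj₂ _ z (dbl (∈-map⁺ proj₂ c∈))
...   | (x₁ , .a) ∷ (x₂ , .a) ∷ [] , s , refl =
  subst₂ (λ b c → b ∷ c ∷ [] ⊆ map proj₁ z)
    (from (con (lookup s (here refl)) c∈) refl)
    (from (con (lookup s (there (here refl))) c∈) refl)
    (Sublist.map⁺ proj₁ s)

-- Words read from left to right

-- The matchings are enumerated letter by letter so that counting can follow the recursion of
-- `completions`. Of the prefix already read, only the open letters and the next new letter matter.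
continuations : List ℕ → ℕ → ℕ → List (List ℕ)
continuations e f zero    = if null e then [ [] ] else []
continuations e f (suc L) = map (f ∷_) (continuations (f ∷ e) (suc f) L) ++
  concatMap (λ (pre , x , post) → map (x ∷_) (continuations (pre ++ post) f L)) (splits e)

sumOver-continuations : ∀ (g : List ℕ → ℕ) e f L → sumOver g (continuations e f (suc L)) ≡
  sumOver (g ∘ (f ∷_)) (continuations (f ∷ e) (suc f) L) +
  sumOver (λ (pre , x , post) → sumOver (g ∘ (x ∷_)) (continuations (pre ++ post) f L)) (splits e)
sumOver-continuations g e f L = trans (sumOver-++ g (map (f ∷_) (continuations (f ∷ e) (suc f) L)) _)
  (cong₂ _+_ (sumOver-map g (f ∷_) (continuations (f ∷ e) (suc f) L))
    (trans (sumOver-concatMap g _ (splits e))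
      (sumOver-cong (splits e) λ {(pre , x , post)} _ → sumOver-map g (x ∷_) (continuations (pre ++ post) f L))))

data Continuation : List ℕ → ℕ → List ℕ → Set where
  ends   : Continuation [] f []
  opens : Continuation (f ∷ e) (suc f) w → Continuation e f (f ∷ w)
  closes : ∀ pre x post → e ≡ pre ++ x ∷ post → Continuation (pre ++ post) f w → Continuation e f (x ∷ w)

continuations-∈⁻ : ∀ e f L → w ∈ continuations e f L → Continuation e f w × length w ≡ L
continuations-∈⁻ []      f zero    (here refl) = ends , refl
continuations-∈⁻ e       f (suc L) w∈ with ∈-++⁻ (map (f ∷_) (continuations (f ∷ e) (suc f) L)) w∈
... | inj₁ w∈ˡ with _ , w′∈ , refl ← ∈-map⁻ (f ∷_) w∈ˡ =
  let c , len = continuations-∈⁻ (f ∷ e) (suc f) L w′∈ in opens c , cong suc len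
... | inj₂ w∈ʳ with (pre , x , post) , s∈ , w∈′ ← find (∈-concatMap⁻ _ {xs = splits e} w∈ʳ)
               with _ , w′∈ , refl ← ∈-map⁻ (x ∷_) w∈′ =
  let c , len = continuations-∈⁻ (pre ++ post) f L w′∈
  in closes pre x post (splits-∈⁻ e s∈) c , cong suc len

continuations-∈⁺ : Continuation e f w → w ∈ continuations e f (length w)
continuations-∈⁺ ends = here refl
continuations-∈⁺ {e} {f} {_ ∷ w} (opens c) = ∈-++⁺ˡ (∈-map⁺ (f ∷_) (continuations-∈⁺ c))
continuations-∈⁺ {e} {f} {_ ∷ w} (closes pre x post refl c) =
  ∈-++⁺ʳ (map (f ∷_) (continuations (f ∷ e) (suc f) (length w)))
    (∈-concatMap⁺ _ (Any.map (λ { refl → ∈-map⁺ (x ∷_) (continuations-∈⁺ c) }) (splits-∈⁺ pre x post)))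

∈-remove : ∀ (pre : List A) {x post y} → y ∈ pre ++ x ∷ post → y ≡ x ⊎ y ∈ pre ++ post
∈-remove []        (here eq)   = inj₁ eq
∈-remove []        (there y∈)  = inj₂ y∈
∈-remove (_ ∷ pre) (here eq)   = inj₂ (here eq)
∈-remove (_ ∷ pre) (there y∈)  = Sum.map₂ there (∈-remove pre y∈)

remove-⊆ : ∀ (pre : List A) x post → pre ++ post ⊆ pre ++ x ∷ post
remove-⊆ pre x post = ++⁺ {as = pre} ⊆-refl (x ∷ʳ ⊆-refl)

length-remove : ∀ (pre : List A) x post → length (pre ++ post) ≡ pred (length (pre ++ x ∷ post))
length-remove pre x post = sym (cong pred
  (trans (length-++ pre) (trans (+-suc (length pre) (length post)) (cong suc (sym (length-++ pre))))))

continuation-letters : Continuation e f w → All (λ y → y ∈ e ⊎ f ≤ y) w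
continuation-letters ends = []
continuation-letters (opens c) = inj₂ ≤-refl ∷ All.map
  [ (λ { (here refl) → inj₂ ≤-refl ; (there y∈) → inj₁ y∈ }) , inj₂ ∘ <⇒≤ ]′ (continuation-letters c)
continuation-letters (closes pre x post refl c) =
  inj₁ (∈-insert pre) ∷ All.map (Sum.map₁ (lookup (remove-⊆ pre x post))) (continuation-letters c)

AllPairs-resp-⊆ : ∀ {R : A → A → Set} {xs ys} → xs ⊆ ys → AllPairs R ys → AllPairs R xs
AllPairs-resp-⊆ []         []       = []
AllPairs-resp-⊆ (_ ∷ʳ s)   (_ ∷ rs) = AllPairs-resp-⊆ s rs
AllPairs-resp-⊆ (refl ∷ s) (r ∷ rs) = All-resp-⊆ s r ∷ AllPairs-resp-⊆ s rs

AllPairs-removed : ∀ {R : A → A → Set} pre {x post} → AllPairs R (pre ++ x ∷ post) →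
  All (λ y → R y x) pre × All (R x) post
AllPairs-removed []        (r ∷ _)  = [] , r
AllPairs-removed (y ∷ pre) (r ∷ rs) =
  let r₁ , r₂ = AllPairs-removed pre rs in All.lookup r (∈-insert pre) ∷ r₁ , r₂

unique-removed : ∀ (pre : List A) {x post} → AllPairs _≢_ (pre ++ x ∷ post) → x ∉ pre ++ post
unique-removed pre u x∈ with ∈-++⁻ pre x∈ | AllPairs-removed pre u
... | inj₁ x∈pre  | r , _ = All.lookup r x∈pre refl
... | inj₂ x∈post | _ , r = All.lookup r x∈post refl

-- Once closed, `y` is neither open nor at least `f`, and `continuation-letters` allows no other
-- letters.
continuation-once : Continuation e f w → AllPairs _≢_ e → All (_< f) e →
  ∀ {y} → y ∈ e → ¬ (y ∷ y ∷ [] ⊆ w)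
continuation-once (opens c) u e<f y∈ (_ ∷ʳ s) =
  continuation-once c (All.map (λ y<f → ≢-sym (<⇒≢ y<f)) e<f ∷ u) (≤-refl ∷ All.map m<n⇒m<1+n e<f) (there y∈) s
continuation-once (opens c) u e<f y∈ (refl ∷ s) = <-irrefl refl (All.lookup e<f y∈)
continuation-once (closes pre x post refl c) u e<f y∈ (_ ∷ʳ s) with ∈-remove pre y∈
... | inj₂ y∈′ = continuation-once c (AllPairs-resp-⊆ (remove-⊆ pre x post) u) (All-resp-⊆ (remove-⊆ pre x post) e<f) y∈′ s
... | inj₁ refl with All.lookup (continuation-letters c) (to∈ (∷ˡ⁻ s))
...   | inj₁ x∈  = unique-removed pre u x∈
...   | inj₂ f≤x = <⇒≱ (All.lookup e<f y∈) f≤x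
continuation-once (closes pre x post refl c) u e<f y∈ (refl ∷ s) with All.lookup (continuation-letters c) (to∈ s)
... | inj₁ x∈  = unique-removed pre u x∈
... | inj₂ f≤x = <⇒≱ (All.lookup e<f y∈) f≤x

sumOver-splits-map : ∀ (h : A → B) (g : List B × B × List B → ℕ) xs → sumOver g (splits (map h xs)) ≡
  sumOver (λ (pre , x , post) → g (map h pre , h x , map h post)) (splits xs)
sumOver-splits-map h g []       = refl
sumOver-splits-map h g (x ∷ xs) = begin
  sumOver g (splits (h x ∷ map h xs))
    ≡⟨ sumOver-splits-∷ g (h x) (map h xs) ⟩
  g ([] , h x , map h xs) + sumOver (λ (pre , y , post) → g (h x ∷ pre , y , post)) (splits (map h xs))
    ≡⟨ cong (g ([] , h x , map h xs) +_) (sumOver-splits-map h (λ (pre , y , post) → g (h x ∷ pre , y , post)) xs) ⟩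
  g ([] , h x , map h xs) + sumOver (λ (pre , y , post) → g (h x ∷ map h pre , h y , map h post)) (splits xs)
    ≡⟨ sumOver-splits-∷ (λ (pre , y , post) → g (map h pre , h y , map h post)) x xs ⟨
  _ ∎

sumOver-continuations-suc : ∀ (g : List ℕ → ℕ) e f L →
  sumOver g (continuations (map suc e) (suc f) L) ≡ sumOver (g ∘ map suc) (continuations e f L)
sumOver-continuations-suc g []      f zero    = refl
sumOver-continuations-suc g (_ ∷ _) f zero    = refl
sumOver-continuations-suc g e       f (suc L) = begin
  sumOver g (continuations (map suc e) (suc f) (suc L))
    ≡⟨ sumOver-continuations g (map suc e) (suc f) L ⟩
  sumOver (g ∘ (suc f ∷_)) (continuations (map suc (f ∷ e)) (suc (suc f)) L) + sumOver _ (splits (map suc e))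
    ≡⟨ cong₂ _+_ (sumOver-continuations-suc (g ∘ (suc f ∷_)) (f ∷ e) (suc f) L)
         (trans (sumOver-splits-map suc _ e) (sumOver-cong (splits e) λ {(pre , x , post)} _ →
           trans (cong (λ e′ → sumOver (g ∘ (suc x ∷_)) (continuations e′ (suc f) L)) (sym (map-++ suc pre post)))
                 (sumOver-continuations-suc (g ∘ (suc x ∷_)) (pre ++ post) f L))) ⟩
  _ ≡⟨ sumOver-continuations (g ∘ map suc) e f L ⟨
  sumOver (g ∘ map suc) (continuations e f (suc L)) ∎

-- After the old edges are erased, the remaining matching starts with the letter `f`; this brings
-- its letters down to 0.
sumOver-continuations-fresh : ∀ (g : List ℕ → ℕ) → (∀ w → g (map suc w) ≡ g w) → ∀ f L →
  sumOver g (continuations [] f L) ≡ sumOver g (continuations [] 0 L)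
sumOver-continuations-fresh g inv zero    L = refl
sumOver-continuations-fresh g inv (suc f) L = begin
  sumOver g (continuations [] (suc f) L)       ≡⟨ sumOver-continuations-suc g [] f L ⟩
  sumOver (g ∘ map suc) (continuations [] f L) ≡⟨ sumOver-cong (continuations [] f L) (λ {w} _ → inv w) ⟩
  sumOver g (continuations [] f L)             ≡⟨ sumOver-continuations-fresh g inv f L ⟩
  sumOver g (continuations [] 0 L)             ∎

-- Erasing the right ends of old edges

module Erasure (f₀ : ℕ) where

  erase : List ℕ → List ℕ
  erase = filter (f₀ ≤?_)

  -- The `h` old right ends occupy any `h` of the `L` places in any order, and the other letters
  -- continue `new` on their own. In the induction the next letter either survives the erasure or is
  -- one of the `h` old right ends, and Pascal's rule adds the two cases. The list `new` is empty
  -- where the lemma is applied; the induction needs it general.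
  sumOver-erase : ∀ L (g : List ℕ → ℕ) new old f → f₀ ≤ f → All (f₀ ≤_) new → All (_< f₀) old →
    sumOver (g ∘ erase) (continuations (new ++ old) f L) ≡
    (L C length old) * length old ! * sumOver g (continuations new f (L ∸ length old))
  sumOver-erase zero g []      []      f _ _ _ = sym (+-identityʳ _)
  sumOver-erase zero g (_ ∷ _) []      f _ _ _ = refl
  sumOver-erase zero g []      (_ ∷ o) f _ _ _
    rewrite k>n⇒nCk≡0 {0} {suc (length o)} z<s = refl
  sumOver-erase zero g (_ ∷ _) (_ ∷ o) f _ _ _
    rewrite k>n⇒nCk≡0 {0} {suc (length o)} z<s = refl
  sumOver-erase (suc L) g new old f f₀≤f f₀≤new old<f₀ = begin
    sumOver (g ∘ erase) (continuations (new ++ old) f (suc L))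
      ≡⟨ sumOver-continuations (g ∘ erase) (new ++ old) f L ⟩
    sumOver (g ∘ erase ∘ (f ∷_)) (continuations (f ∷ new ++ old) (suc f) L) + sumOver _ (splits (new ++ old))
      ≡⟨ cong₂ _+_ opening (sumOver-splits-++ _ new old) ⟩
    c * sumOver (g ∘ (f ∷_)) (continuations (f ∷ new) (suc f) (L ∸ h)) +
      (sumOver (λ (pre , x , post) → sumOver (g ∘ erase ∘ (x ∷_)) (continuations (pre ++ (post ++ old)) f L)) (splits new) +
       sumOver (λ (pre , x , post) → sumOver (g ∘ erase ∘ (x ∷_)) (continuations ((new ++ pre) ++ post) f L)) (splits old))
      ≡⟨ cong₂ (λ x y → c * sumOver (g ∘ (f ∷_)) (continuations (f ∷ new) (suc f) (L ∸ h)) + (x + y)) closing-new closing-old ⟩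
    c * sumOver (g ∘ (f ∷_)) (continuations (f ∷ new) (suc f) (L ∸ h)) +
      (c * sumOver (λ (pre , x , post) → sumOver (g ∘ (x ∷_)) (continuations (pre ++ post) f (L ∸ h))) (splits new) + d)
      ≡⟨ regroup c _ _ d ⟩
    c * (sumOver (g ∘ (f ∷_)) (continuations (f ∷ new) (suc f) (L ∸ h)) +
      sumOver (λ (pre , x , post) → sumOver (g ∘ (x ∷_)) (continuations (pre ++ post) f (L ∸ h))) (splits new)) + d
      ≡⟨ cong (λ x → c * x + d) (sumOver-continuations g new f (L ∸ h)) ⟨
    c * sumOver g (continuations new f (suc (L ∸ h))) + d
      ≡⟨ pascal old ⟩
    (suc L C h) * h ! * sumOver g (continuations new f (suc L ∸ h)) ∎
    where
    h c d : ℕ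
    h = length old
    c = (L C h) * h !
    d = h * ((L C pred h) * pred h ! * sumOver g (continuations new f (L ∸ pred h)))

    regroup : ∀ c x y d → c * x + (c * y + d) ≡ c * (x + y) + d
    regroup = solve-∀

    opening : sumOver (g ∘ erase ∘ (f ∷_)) (continuations (f ∷ new ++ old) (suc f) L) ≡
      c * sumOver (g ∘ (f ∷_)) (continuations (f ∷ new) (suc f) (L ∸ h))
    opening = trans
      (sumOver-cong (continuations (f ∷ new ++ old) (suc f) L) λ _ → cong g (filter-accept (f₀ ≤?_) f₀≤f))
      (sumOver-erase L (g ∘ (f ∷_)) (f ∷ new) old (suc f) (m≤n⇒m≤1+n f₀≤f) (f₀≤f ∷ f₀≤new) old<f₀)

    closing-new :
      sumOver (λ (pre , x , post) → sumOver (g ∘ erase ∘ (x ∷_)) (continuations (pre ++ (post ++ old)) f L)) (splits new) ≡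
      c * sumOver (λ (pre , x , post) → sumOver (g ∘ (x ∷_)) (continuations (pre ++ post) f (L ∸ h))) (splits new)
    closing-new = trans (sumOver-cong (splits new) (λ {(pre , x , post)} s∈ → one pre x post (splits-∈⁻ new s∈)))
      (sumOver-*ˡ c _ (splits new))
      where
      one : ∀ pre x post → new ≡ pre ++ x ∷ post →
        sumOver (g ∘ erase ∘ (x ∷_)) (continuations (pre ++ (post ++ old)) f L) ≡
        c * sumOver (g ∘ (x ∷_)) (continuations (pre ++ post) f (L ∸ h))
      one pre x post refl = begin
        sumOver (g ∘ erase ∘ (x ∷_)) (continuations (pre ++ (post ++ old)) f L)
          ≡⟨ cong (λ e → sumOver (g ∘ erase ∘ (x ∷_)) (continuations e f L)) (++-assoc pre post old) ⟨
        sumOver (g ∘ erase ∘ (x ∷_)) (continuations ((pre ++ post) ++ old) f L)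
          ≡⟨ sumOver-cong (continuations ((pre ++ post) ++ old) f L) (λ _ →
               cong g (filter-accept (f₀ ≤?_) (All.lookup f₀≤new (∈-insert pre)))) ⟩
        sumOver (g ∘ (x ∷_) ∘ erase) (continuations ((pre ++ post) ++ old) f L)
          ≡⟨ sumOver-erase L (g ∘ (x ∷_)) (pre ++ post) old f f₀≤f (All-resp-⊆ (remove-⊆ pre x post) f₀≤new) old<f₀ ⟩
        c * sumOver (g ∘ (x ∷_)) (continuations (pre ++ post) f (L ∸ h)) ∎

    closing-old :
      sumOver (λ (pre , x , post) → sumOver (g ∘ erase ∘ (x ∷_)) (continuations ((new ++ pre) ++ post) f L)) (splits old) ≡ d
    closing-old = begin
      sumOver (λ (pre , x , post) → sumOver (g ∘ erase ∘ (x ∷_)) (continuations ((new ++ pre) ++ post) f L)) (splits old)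
        ≡⟨ sumOver-cong (splits old) (λ {(pre , x , post)} s∈ → one pre x post (splits-∈⁻ old s∈)) ⟩
      sumOver (λ _ → (L C pred h) * pred h ! * sumOver g (continuations new f (L ∸ pred h))) (splits old)
        ≡⟨ sumOver-const _ (splits old) ⟩
      length (splits old) * ((L C pred h) * pred h ! * sumOver g (continuations new f (L ∸ pred h)))
        ≡⟨ cong (_* ((L C pred h) * pred h ! * sumOver g (continuations new f (L ∸ pred h)))) (length-splits old) ⟩
      d ∎
      where
      one : ∀ pre x post → old ≡ pre ++ x ∷ post →
        sumOver (g ∘ erase ∘ (x ∷_)) (continuations ((new ++ pre) ++ post) f L) ≡
        (L C pred h) * pred h ! * sumOver g (continuations new f (L ∸ pred h))
      one pre x post refl = begin
        sumOver (g ∘ erase ∘ (x ∷_)) (continuations ((new ++ pre) ++ post) f L)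
          ≡⟨ cong (λ e → sumOver (g ∘ erase ∘ (x ∷_)) (continuations e f L)) (++-assoc new pre post) ⟩
        sumOver (g ∘ erase ∘ (x ∷_)) (continuations (new ++ (pre ++ post)) f L)
          ≡⟨ sumOver-cong (continuations (new ++ (pre ++ post)) f L) (λ _ →
               cong g (filter-reject (f₀ ≤?_) (<⇒≱ (All.lookup old<f₀ (∈-insert pre))))) ⟩
        sumOver (g ∘ erase) (continuations (new ++ (pre ++ post)) f L)
          ≡⟨ sumOver-erase L g new (pre ++ post) f f₀≤f f₀≤new (All-resp-⊆ (remove-⊆ pre x post) old<f₀) ⟩
        (L C length (pre ++ post)) * length (pre ++ post) ! * sumOver g (continuations new f (L ∸ length (pre ++ post)))
          ≡⟨ cong (λ k → (L C k) * k ! * sumOver g (continuations new f (L ∸ k))) (length-remove pre x post) ⟩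
        (L C pred h) * pred h ! * sumOver g (continuations new f (L ∸ pred h)) ∎

    pascal : ∀ old → (L C length old) * length old ! * sumOver g (continuations new f (suc (L ∸ length old))) +
      length old * ((L C pred (length old)) * pred (length old) ! * sumOver g (continuations new f (L ∸ pred (length old)))) ≡
      (suc L C length old) * length old ! * sumOver g (continuations new f (suc L ∸ length old))
    pascal []        = +-identityʳ _
    pascal (_ ∷ old) = begin
      (L C suc k) * (suc k * k !) * sumOver g (continuations new f (suc (L ∸ suc k))) + suc k * ((L C k) * k ! * X)
        ≡⟨ cong (_+ suc k * ((L C k) * k ! * X)) same ⟩
      (L C suc k) * (suc k * k !) * X + suc k * ((L C k) * k ! * X)
        ≡⟨ r (L C suc k) (suc k) (k !) X (L C k) ⟩
      (L C k + L C suc k) * (suc k * k !) * X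
        ≡⟨ cong (λ x → x * (suc k * k !) * X) (nCk+nC[k+1]≡[n+1]C[k+1] L k) ⟩
      (suc L C suc k) * (suc k * k !) * X ∎
      where
      k X : ℕ
      k = length old
      X = sumOver g (continuations new f (L ∸ k))
      r : ∀ a b c x d → a * (b * c) * x + b * (d * c * x) ≡ (d + a) * (b * c) * x
      r = solve-∀
      -- For `k ≥ L` the truncated lengths on the two sides may differ, but then the binomial
      -- coefficient is 0.
      same : (L C suc k) * (suc k * k !) * sumOver g (continuations new f (suc (L ∸ suc k))) ≡
        (L C suc k) * (suc k * k !) * X
      same with k <? L
      ... | yes k<L = cong (λ j → (L C suc k) * (suc k * k !) * sumOver g (continuations new f j)) (sym (+-∸-assoc 1 k<L))
      ... | no  k≮L rewrite k>n⇒nCk≡0 {L} {suc k} (s≤s (≮⇒≥ k≮L)) = refl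

-- Words avoiding σ(τ+2)

avoiding : List ℕ → List ℕ → ℕ
avoiding v w = indicator (not (does (occurs? v w)))

avoiders : List ℕ → ℕ → ℕ
avoiders v L = sumOver (avoiding v) (continuations [] 0 L)

avoiding-⇔ : ∀ {v w v′ w′} → Occurs v w ⇔ Occurs v′ w′ → avoiding v w ≡ avoiding v′ w′
avoiding-⇔ {v} {w} {v′} {w′} eq = cong (indicator ∘ not) (does-⇔ eq (occurs? v w) (occurs? v′ w′))

juxtapose : List ℕ → List ℕ → List ℕ
juxtapose σ τ = σ ++ map (2 +_) τ

-- An occurrence of `τ` contains each of its letters twice, whereas the letters open at the start
-- appear at most once in `w`. So only letters from `f` on are used.
occurs-erase : ∀ {e f w τ} → Continuation e f w → AllPairs _≢_ e → All (_< f) e → Doubled τ →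
  Occurs τ w ⇔ Occurs τ (Erasure.erase f w)
occurs-erase {e} {f} {w} {τ} c u e<f dbl = mk⇔ forth (Occurs-⊆ (filter-⊆ (f ≤?_) w))
  where
  forth : Occurs τ w → Occurs τ (Erasure.erase f w)
  forth (z , refl , s , con) = z , refl ,
    subst (_⊆ Erasure.erase f w) (filter-all (f ≤?_) (All.tabulate new)) (filter⁺ (f ≤?_) (f ≤?_) (λ { refl → id }) s) , con
    where
    new : ∀ {a} → a ∈ map proj₁ z → f ≤ a
    new a∈ with All.lookup (continuation-letters c) (lookup s a∈)
    ... | inj₁ a∈e = contradiction (⊆-trans (Doubled-occurrence con dbl a∈) s) (continuation-once c u e<f a∈e)
    ... | inj₂ f≤a = f≤a

-- The part for `σ` does not fit into `p`, so it reaches `x` and the part for `τ` lies in `w`.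
juxtapose-occurs⁻ : ∀ {σ τ p x w} → ¬ Occurs σ p → Occurs (juxtapose σ τ) (p ++ x ∷ w) → Occurs τ w
juxtapose-occurs⁻ {σ} {τ} {p} {x} {w} ¬occ (z , eq , s , con) with map-++⁻ proj₂ z σ eq
... | z₁ , z₂ , refl , refl , eq₂ with ⊆-++⁻ (map proj₁ z₁) p (subst (_⊆ p ++ x ∷ w) (map-++ proj₁ z₁ z₂) s)
...   | inj₁ s₁ = ⊥-elim (¬occ (z₁ , refl , s₁ , Consistent-⊆ (++⁺ʳ z₂ ⊆-refl) con))
...   | inj₂ s₂ = to (relabel-pattern (+-cancelˡ-≡ 2 _ _)) (z₂ , eq₂ , s₂ , Consistent-⊆ (++⁺ˡ z₁ ⊆-refl) con)

-- The two occurrences share no letter: the first uses letters that appear twice in `p`, which are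
-- closed and do not recur in `w`. In the pattern, letters below 2 face letters from 2 on.
juxtapose-occurs⁺ : ∀ {σ τ p w} → All (_< 2) σ → Doubled σ →
  (∀ {a} → a ∷ a ∷ [] ⊆ p → a ∉ w) → Occurs σ p → Occurs τ w → Occurs (juxtapose σ τ) (p ++ w)
juxtapose-occurs⁺ {σ} {τ} {p} {w} σ<2 dbl disjoint (z₁ , refl , s₁ , con₁) occ
  with from (relabel-pattern (+-cancelˡ-≡ 2 _ _)) occ
... | z₂ , eq₂ , s₂ , con₂ = z₁ ++ z₂ ,
  trans (map-++ proj₂ z₁ z₂) (cong (map proj₂ z₁ ++_) eq₂) ,
  subst (_⊆ p ++ w) (sym (map-++ proj₁ z₁ z₂)) (++⁺ s₁ s₂) ,
  λ c∈ d∈ → relate (∈-++⁻ z₁ c∈) (∈-++⁻ z₁ d∈)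
  where
  cross₁ : ∀ {c d} → c ∈ z₁ → d ∈ z₂ → proj₁ c ≢ proj₁ d
  cross₁ c∈ d∈ eq = disjoint (⊆-trans (Doubled-occurrence con₁ dbl (∈-map⁺ proj₁ c∈)) s₁)
    (subst (_∈ w) (sym eq) (lookup s₂ (∈-map⁺ proj₁ d∈)))
  cross₂ : ∀ {c d} → c ∈ z₁ → d ∈ z₂ → proj₂ c ≢ proj₂ d
  cross₂ c∈ d∈ eq with b , _ , eq′ ← ∈-map⁻ (2 +_) (subst (_ ∈_) eq₂ (∈-map⁺ proj₂ d∈)) =
    <⇒≱ (All.lookup σ<2 (∈-map⁺ proj₂ c∈)) (≤-trans (m≤m+n 2 b) (≤-reflexive (sym (trans eq eq′))))
  relate : ∀ {c d} → c ∈ z₁ ⊎ c ∈ z₂ → d ∈ z₁ ⊎ d ∈ z₂ → proj₁ c ≡ proj₁ d ⇔ proj₂ c ≡ proj₂ d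
  relate (inj₁ c∈) (inj₁ d∈) = con₁ c∈ d∈
  relate (inj₂ c∈) (inj₂ d∈) = con₂ c∈ d∈
  relate (inj₁ c∈) (inj₂ d∈) = mk⇔ (⊥-elim ∘ cross₁ c∈ d∈) (⊥-elim ∘ cross₂ c∈ d∈)
  relate (inj₂ c∈) (inj₁ d∈) = mk⇔ (⊥-elim ∘ cross₁ d∈ c∈ ∘ sym) (⊥-elim ∘ cross₂ d∈ c∈ ∘ sym)

-- p is a prefix of a matching, e its open letters with the latest first, and
-- f the next letter to be opened.
record State (p e : List ℕ) (f : ℕ) : Set where
  field
    below   : All (_< f) p
    opened  : All (_∈ p) e
    once    : All (λ y → ¬ (y ∷ y ∷ [] ⊆ p)) e
    ordered : AllPairs (λ x y → (y ∷ x ∷ [] ⊆ p) × ¬ (x ∷ y ∷ [] ⊆ p)) e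

  fresh : f ∉ p
  fresh f∈ = <-irrefl refl (All.lookup below f∈)

  unique : AllPairs _≢_ e
  unique = AllPairs.map (λ { (s , ¬s) refl → ¬s s }) ordered

  open-below : All (_< f) e
  open-below = All.map (All.lookup below) opened

open State

initial : State [] [] 0
initial = record { below = [] ; opened = [] ; once = [] ; ordered = [] }

AllPairs-All : ∀ {R : A → A → Set} {P : A → Set} {xs} → AllPairs R xs → All P xs →
  AllPairs (λ x y → R x y × P y) xs
AllPairs-All []       []       = []
AllPairs-All (r ∷ rs) (_ ∷ ps) = All.zip (r , ps) ∷ AllPairs-All rs ps

snoc-⊆ : ∀ u {y x : ℕ} {p} → y ≢ x → u ++ [ y ] ⊆ p ++ [ x ] → u ++ [ y ] ⊆ p
snoc-⊆ u {p = p} y≢x s with ⊆-snoc⁻ u p s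
... | inj₁ s′       = s′
... | inj₂ (eq , _) = contradiction eq y≢x

state-open : State p e f → State (p ++ [ f ]) (f ∷ e) (suc f)
state-open {p} {e} {f} st = record
  { below   = All.++⁺ (All.map m<n⇒m<1+n (below st)) (≤-refl ∷ [])
  ; opened  = ∈-++⁺ʳ p (here refl) ∷ All.map ∈-++⁺ˡ (opened st)
  ; once    = (λ s → [ fresh st ∘ to∈ , (λ (_ , s′) → fresh st (to∈ s′)) ]′ (⊆-snoc⁻ [ f ] p s)) ∷
      All.zipWith (λ (y∈ , ¬s) → ¬s ∘ snoc-⊆ [ _ ] (≢f y∈)) (opened st , once st)
  ; ordered = All.map (λ y∈ → ⊆-snoc (from∈ y∈) , fresh st ∘ to∈ ∘ snoc-⊆ [ f ] (≢f y∈)) (opened st) ∷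
      AllPairs.map (λ (s , ¬s) → ++⁺ʳ [ f ] s , ¬s ∘ snoc-⊆ [ _ ] (≢f (to∈ s))) (ordered st)
  }
  where
  ≢f : ∀ {y} → y ∈ p → y ≢ f
  ≢f y∈ refl = fresh st y∈

state-close : ∀ pre x post → State p (pre ++ x ∷ post) f → State (p ++ [ x ]) (pre ++ post) f
state-close {p} {f} pre x post st = record
  { below   = All.++⁺ (below st) (All.lookup (below st) (All.lookup (opened st) (∈-insert pre)) ∷ [])
  ; opened  = All.map ∈-++⁺ˡ (All-resp-⊆ sub (opened st))
  ; once    = All.zipWith (λ (¬s , y≢x) → ¬s ∘ snoc-⊆ [ _ ] y≢x) (All-resp-⊆ sub (once st) , ≢x)
  ; ordered = AllPairs.map (λ ((s , ¬s) , y≢x) → ++⁺ʳ [ x ] s , ¬s ∘ snoc-⊆ [ _ ] y≢x)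
      (AllPairs-All (AllPairs-resp-⊆ sub (ordered st)) ≢x)
  }
  where
  sub : pre ++ post ⊆ pre ++ x ∷ post
  sub = remove-⊆ pre x post
  ≢x : All (_≢ x) (pre ++ post)
  ≢x = All.tabulate λ { y∈ refl → unique-removed pre (unique st) y∈ }

-- How danger spreads among the open edges

data Side : Set where
  later earlier : Side

Spreads : Side → ℕ → ℕ → List ℕ → Set
Spreads later   z y p = z ∷ y ∷ [] ⊆ p
Spreads earlier z y p = y ∷ z ∷ [] ⊆ p

-- Open letters are listed with the latest first, so the `i` letters in front of the closed one are
-- those opened later.
affected unaffected : Side → ℕ → ℕ → ℕ
affected   later   i j = i
affected   earlier i j = j
unaffected later   i j = j
unaffected earlier i j = i

-- An open letter y of a prefix p without occurrence of σ is dangerous if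
-- p ++ [ y ] has one.  Closing a safe letter makes dangerous precisely the open
-- letters on one side of it.
record Spreading (σ : List ℕ) : Set where
  field
    small       : All (_< 2) σ
    doubled     : Doubled σ
    side        : Side
    open-avoids : ∀ {p f} → f ∉ p → ¬ Occurs σ p → ¬ Occurs σ (p ++ [ f ])
    open-safe   : ∀ {p f} → f ∉ p → ¬ Occurs σ p → ¬ Occurs σ ((p ++ [ f ]) ++ [ f ])
    spread⁺     : ∀ {p z y} → z ≢ y → Spreads side z y p → Occurs σ ((p ++ [ z ]) ++ [ y ])
    spread⁻     : ∀ {p z y} → z ≢ y → ¬ Occurs σ (p ++ [ z ]) → Occurs σ ((p ++ [ z ]) ++ [ y ]) →
      Occurs σ (p ++ [ y ]) ⊎ Spreads side z y p

module _ {P Q : A → Set} (P? : ∀ x → Dec (P x)) (Q? : ∀ x → Dec (Q x)) where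

  same-satisfying : ∀ xs → (∀ {x} → x ∈ xs → P x ⇔ Q x) → satisfying P? xs ≡ satisfying Q? xs
  same-satisfying xs eq = sumOver-cong xs λ {x} x∈ → cong indicator (does-⇔ (eq x∈) (P? x) (Q? x))

  same-failing : ∀ xs → (∀ {x} → x ∈ xs → P x ⇔ Q x) → failing P? xs ≡ failing Q? xs
  same-failing xs eq = sumOver-cong xs λ {x} x∈ → cong (indicator ∘ not) (does-⇔ (eq x∈) (P? x) (Q? x))

all-satisfying : ∀ {P : A → Set} (P? : ∀ x → Dec (P x)) xs → (∀ {x} → x ∈ xs → P x) →
  satisfying P? xs ≡ length xs × failing P? xs ≡ 0
all-satisfying P? xs all =
  trans (sumOver-cong xs λ {x} x∈ → cong indicator (dec-true (P? x) (all x∈)))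
    (trans (sumOver-const 1 xs) (*-identityʳ (length xs))) ,
  trans (sumOver-cong xs λ {x} x∈ → cong (indicator ∘ not) (dec-true (P? x) (all x∈)))
    (trans (sumOver-const 0 xs) (*-zeroʳ (length xs)))

-- The recursion for words avoiding the juxtaposition

module Avoiders (σ τ : List ℕ) (spr : Spreading σ) (doubledτ : Doubled τ) where
  open Spreading spr
  open Counting (suffixes (avoiders τ))

  dangerous? : ∀ p y → Dec (Occurs σ (p ++ [ y ]))
  dangerous? p y = occurs? σ (p ++ [ y ])

  t s : List ℕ → List ℕ → ℕ
  t p = satisfying (dangerous? p)
  s p = failing (dangerous? p)

  mono : ∀ {z} y → Occurs σ (p ++ [ y ]) → Occurs σ ((p ++ [ z ]) ++ [ y ])
  mono {z = z} y = Occurs-⊆ (⊆-snoc (++⁺ʳ [ z ] ⊆-refl))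

  module _ {p e f} (st : State p e f) (avoids : ¬ Occurs σ p) where

    -- `spread⁻` is applied with the opened letter `f` in place of a closed one: as `f ∉ p`, nothing
    -- can spread from it.
    open-dangerous : ∀ {y} → y ∈ e → Occurs σ ((p ++ [ f ]) ++ [ y ]) ⇔ Occurs σ (p ++ [ y ])
    open-dangerous {y} y∈ = mk⇔
      (λ occ → [ id , ⊥-elim ∘ fresh st ∘ f∈ side ]′ (spread⁻ f≢y (open-avoids (fresh st) avoids) occ)) (mono y)
      where
      f≢y : f ≢ y
      f≢y refl = fresh st (All.lookup (opened st) y∈)
      f∈ : ∀ side → Spreads side f y p → f ∈ p
      f∈ later   s = lookup s (here refl)
      f∈ earlier s = lookup s (there (here refl))

    t-open : t (p ++ [ f ]) (f ∷ e) ≡ t p e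
    t-open = cong₂ _+_ (cong indicator (dec-false (dangerous? (p ++ [ f ]) f) (open-safe (fresh st) avoids)))
      (same-satisfying (dangerous? (p ++ [ f ])) (dangerous? p) e open-dangerous)

    s-open : s (p ++ [ f ]) (f ∷ e) ≡ suc (s p e)
    s-open = cong₂ _+_ (cong (indicator ∘ not) (dec-false (dangerous? (p ++ [ f ]) f) (open-safe (fresh st) avoids)))
      (same-failing (dangerous? (p ++ [ f ])) (dangerous? p) e open-dangerous)

  -- As `x` completes the first `σ`, only the occurrences of `τ` in the rest count, and these
  -- survive the erasure of the edges still open.
  stop-dangerous : ∀ pre x post → State p (pre ++ x ∷ post) f → ¬ Occurs σ p → Occurs σ (p ++ [ x ]) →
    sumOver (λ w → avoiding (juxtapose σ τ) (p ++ x ∷ w)) (continuations (pre ++ post) f L) ≡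
    suffixes (avoiders τ) (length (pre ++ post)) L
  stop-dangerous {p} {f} {L} pre x post st avoids occ = begin
    sumOver (λ w → avoiding (juxtapose σ τ) (p ++ x ∷ w)) (continuations (pre ++ post) f L)
      ≡⟨ sumOver-cong (continuations (pre ++ post) f L)
           (λ w∈ → avoiding-⇔ (forget (proj₁ (continuations-∈⁻ (pre ++ post) f L w∈)))) ⟩
    sumOver (avoiding τ ∘ Erasure.erase f) (continuations (pre ++ post) f L)
      ≡⟨ Erasure.sumOver-erase f L (avoiding τ) [] (pre ++ post) f ≤-refl [] (open-below st′) ⟩
    (L C h) * h ! * sumOver (avoiding τ) (continuations [] f (L ∸ h))
      ≡⟨ cong ((L C h) * h ! *_) (sumOver-continuations-fresh (avoiding τ)
           (λ w → avoiding-⇔ {τ} {map suc w} {τ} {w} (relabel-word suc-injective)) f (L ∸ h)) ⟩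
    suffixes (avoiders τ) h L ∎
    where
    h : ℕ
    h = length (pre ++ post)
    st′ : State (p ++ [ x ]) (pre ++ post) f
    st′ = state-close pre x post st
    forget : ∀ {w} → Continuation (pre ++ post) f w →
      Occurs (juxtapose σ τ) (p ++ x ∷ w) ⇔ Occurs τ (Erasure.erase f w)
    forget {w} c = mk⇔ (to erased ∘ juxtapose-occurs⁻ avoids)
      (subst (Occurs (juxtapose σ τ)) (++-assoc p [ x ] w) ∘ juxtapose-occurs⁺ small doubled disjoint occ ∘ from erased)
      where
      erased : Occurs τ w ⇔ Occurs τ (Erasure.erase f w)
      erased = occurs-erase c (unique st′) (open-below st′) doubledτ
      disjoint : ∀ {a} → a ∷ a ∷ [] ⊆ p ++ [ x ] → a ∉ w
      disjoint aa a∈ with All.lookup (continuation-letters c) a∈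
      ... | inj₁ a∈e = All.lookup (once st′) a∈e aa
      ... | inj₂ f≤a = <⇒≱ (All.lookup (below st′) (lookup aa (here refl))) f≤a

  module _ {p pre x post f} (st : State p (pre ++ x ∷ post) f) (safe : ¬ Occurs σ (p ++ [ x ])) where

    x∉ : x ∉ pre ++ post
    x∉ = unique-removed pre (unique st)

    spread : ∀ {y} → y ∈ pre ++ post → Spreads side x y p → Occurs σ ((p ++ [ x ]) ++ [ y ])
    spread y∈ = spread⁺ λ { refl → x∉ y∈ }

    unspread : ∀ {y} → y ∈ pre ++ post → ¬ Spreads side x y p →
      Occurs σ ((p ++ [ x ]) ++ [ y ]) ⇔ Occurs σ (p ++ [ y ])
    unspread {y} y∈ ¬s = mk⇔ (λ occ → [ id , ⊥-elim ∘ ¬s ]′ (spread⁻ (λ { refl → x∉ y∈ }) safe occ)) (mono y)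

    -- On the affected side every letter becomes dangerous, so the new dangerous ones are the safe
    -- ones there; the other side keeps its status. The side is an argument, together with `hit` and
    -- `miss` for it, to allow a case split.
    closed-counts : ∀ sd →
      (∀ {y} → y ∈ pre ++ post → Spreads sd x y p → Occurs σ ((p ++ [ x ]) ++ [ y ])) →
      (∀ {y} → y ∈ pre ++ post → ¬ Spreads sd x y p → Occurs σ ((p ++ [ x ]) ++ [ y ]) ⇔ Occurs σ (p ++ [ y ])) →
      t (p ++ [ x ]) (pre ++ post) ≡ t p (pre ++ x ∷ post) + affected sd (s p pre) (s p post) ×
      s (p ++ [ x ]) (pre ++ post) ≡ unaffected sd (s p pre) (s p post)
    closed-counts sd hit miss with AllPairs-removed pre (ordered st)
    ... | before , after = counts sd hit miss
      where
      q : List ℕ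
      q = p ++ [ x ]
      t-old : t p (pre ++ x ∷ post) ≡ t p pre + t p post
      t-old = trans (sumOver-++ _ pre (x ∷ post))
        (cong (λ b → t p pre + (indicator b + t p post)) (dec-false (dangerous? p x) safe))
      counts : ∀ sd →
        (∀ {y} → y ∈ pre ++ post → Spreads sd x y p → Occurs σ ((p ++ [ x ]) ++ [ y ])) →
        (∀ {y} → y ∈ pre ++ post → ¬ Spreads sd x y p → Occurs σ ((p ++ [ x ]) ++ [ y ]) ⇔ Occurs σ (p ++ [ y ])) →
        t q (pre ++ post) ≡ t p (pre ++ x ∷ post) + affected sd (s p pre) (s p post) ×
        s q (pre ++ post) ≡ unaffected sd (s p pre) (s p post)
      counts later hit miss = (begin
        t q (pre ++ post)            ≡⟨ sumOver-++ _ pre post ⟩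
        t q pre + t q post           ≡⟨ cong₂ _+_ (trans (proj₁ all-hit) (sym (satisfying+failing (dangerous? p) pre)))
                                          (same-satisfying (dangerous? q) (dangerous? p) post missed) ⟩
        t p pre + s p pre + t p post ≡⟨ r (t p pre) (s p pre) (t p post) ⟩
        t p pre + t p post + s p pre ≡⟨ cong (_+ s p pre) t-old ⟨
        t p (pre ++ x ∷ post) + s p pre ∎) ,
        trans (sumOver-++ _ pre post) (cong₂ _+_ (proj₂ all-hit) (same-failing (dangerous? q) (dangerous? p) post missed))
        where
        all-hit : t q pre ≡ length pre × s q pre ≡ 0
        all-hit = all-satisfying (dangerous? q) pre λ y∈ → hit (∈-++⁺ˡ y∈) (proj₁ (All.lookup before y∈))
        missed : ∀ {y} → y ∈ post → Occurs σ (q ++ [ y ]) ⇔ Occurs σ (p ++ [ y ])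
        missed y∈ = miss (∈-++⁺ʳ pre y∈) (proj₂ (All.lookup after y∈))
        r : ∀ a b c → a + b + c ≡ a + c + b
        r = solve-∀
      counts earlier hit miss = (begin
        t q (pre ++ post)              ≡⟨ sumOver-++ _ pre post ⟩
        t q pre + t q post             ≡⟨ cong₂ _+_ (same-satisfying (dangerous? q) (dangerous? p) pre missed)
                                            (trans (proj₁ all-hit) (sym (satisfying+failing (dangerous? p) post))) ⟩
        t p pre + (t p post + s p post) ≡⟨ +-assoc (t p pre) _ _ ⟨
        t p pre + t p post + s p post  ≡⟨ cong (_+ s p post) t-old ⟨
        t p (pre ++ x ∷ post) + s p post ∎) ,
        trans (sumOver-++ _ pre post)
          (trans (cong₂ _+_ (same-failing (dangerous? q) (dangerous? p) pre missed) (proj₂ all-hit)) (+-identityʳ _))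
        where
        all-hit : t q post ≡ length post × s q post ≡ 0
        all-hit = all-satisfying (dangerous? q) post λ y∈ → hit (∈-++⁺ʳ pre y∈) (proj₁ (All.lookup after y∈))
        missed : ∀ {y} → y ∈ pre → Occurs σ (q ++ [ y ]) ⇔ Occurs σ (p ++ [ y ])
        missed y∈ = miss (∈-++⁺ˡ y∈) (proj₂ (All.lookup before y∈))

  -- Here the two patterns become indistinguishable: they differ by exchanging `i` and `j`, which
  -- only permutes the summands.
  antidiag-side : ∀ sd (F : ℕ → ℕ → ℕ) n →
    antidiag (λ i j → F (affected sd i j) (unaffected sd i j)) n ≡ antidiag F n
  antidiag-side later   F n = refl
  antidiag-side earlier F n = antidiag-flip F n

  count-completions : ∀ L {p e f} → State p e f → ¬ Occurs σ p →
    sumOver (λ w → avoiding (juxtapose σ τ) (p ++ w)) (continuations e f L) ≡ completions (t p e) (s p e) L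
  count-completions zero {p} {[]} st avoids = trans (+-identityʳ _)
    (cong (indicator ∘ not) (dec-false (occurs? (juxtapose σ τ) (p ++ [])) λ (z , eq , sub , con) →
      let z₁ , z₂ , z≡ , eq₁ , _ = map-++⁻ proj₂ z σ eq in
      avoids (z₁ , eq₁ ,
        ⊆-trans (Sublist.map⁺ proj₁ (⊆-trans (++⁺ʳ z₂ ⊆-refl) (⊆-reflexive (sym z≡))))
          (subst (map proj₁ z ⊆_) (++-identityʳ p) sub) ,
        Consistent-⊆ (⊆-trans (++⁺ʳ z₂ ⊆-refl) (⊆-reflexive (sym z≡))) con)))
  -- A word cannot end with open edges; correspondingly `t p e + s p e` is the positive number of
  -- open edges, where `δ` is 0.
  count-completions zero {p} {y ∷ e} st avoids = sym (cong δ (satisfying+failing (dangerous? p) (y ∷ e)))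
  count-completions (suc L) {p} {e} {f} st avoids = begin
    sumOver (λ w → avoiding (juxtapose σ τ) (p ++ w)) (continuations e f (suc L))
      ≡⟨ sumOver-continuations _ e f L ⟩
    sumOver (λ w → avoiding (juxtapose σ τ) (p ++ f ∷ w)) (continuations (f ∷ e) (suc f) L) +
    sumOver (λ (pre , x , post) → sumOver (λ w → avoiding (juxtapose σ τ) (p ++ x ∷ w)) (continuations (pre ++ post) f L)) (splits e)
      ≡⟨ cong₂ _+_ opening closing ⟩
    completions (t p e) (suc (s p e)) L + (t p e * c + antidiag (λ i j → completions (t p e + i) j L) (s p e))
      ≡⟨ r (completions (t p e) (suc (s p e)) L) (t p e * c) _ ⟩
    completions (t p e) (s p e) (suc L) ∎
    where
    c : ℕ
    c = suffixes (avoiders τ) (pred (t p e + s p e)) L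
    r : ∀ a b c → a + (b + c) ≡ a + c + b
    r = solve-∀

    shift-prefix : ∀ x e f → sumOver (λ w → avoiding (juxtapose σ τ) (p ++ x ∷ w)) (continuations e f L) ≡
      sumOver (λ w → avoiding (juxtapose σ τ) ((p ++ [ x ]) ++ w)) (continuations e f L)
    shift-prefix x e f = sumOver-cong (continuations e f L) λ {w} _ →
      cong (avoiding (juxtapose σ τ)) (sym (++-assoc p [ x ] w))

    opening : sumOver (λ w → avoiding (juxtapose σ τ) (p ++ f ∷ w)) (continuations (f ∷ e) (suc f) L) ≡
      completions (t p e) (suc (s p e)) L
    opening = begin
      _ ≡⟨ shift-prefix f (f ∷ e) (suc f) ⟩
      _ ≡⟨ count-completions L (state-open st) (open-avoids (fresh st) avoids) ⟩
      completions (t (p ++ [ f ]) (f ∷ e)) (s (p ++ [ f ]) (f ∷ e)) L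
        ≡⟨ cong₂ (λ i j → completions i j L) (t-open st avoids) (s-open st avoids) ⟩
      completions (t p e) (suc (s p e)) L ∎

    F : ℕ → ℕ → ℕ
    F i j = completions (t p e + affected side i j) (unaffected side i j) L

    one : ∀ pre x post → e ≡ pre ++ x ∷ post →
      sumOver (λ w → avoiding (juxtapose σ τ) (p ++ x ∷ w)) (continuations (pre ++ post) f L) ≡
      (if does (dangerous? p x) then c else F (s p pre) (s p post))
    one pre x post refl with dangerous? p x in dec
    ... | yes danger = trans (stop-dangerous pre x post st avoids danger)
      (cong (λ h → suffixes (avoiders τ) h L)
        (trans (length-remove pre x post) (cong pred (sym (satisfying+failing (dangerous? p) (pre ++ x ∷ post))))))
    ... | no safe = begin
      _ ≡⟨ shift-prefix x (pre ++ post) f ⟩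
      _ ≡⟨ count-completions L (state-close pre x post st) safe ⟩
      completions (t (p ++ [ x ]) (pre ++ post)) (s (p ++ [ x ]) (pre ++ post)) L
        ≡⟨ (let t≡ , s≡ = closed-counts st safe side (spread st safe) (unspread st safe)
            in cong₂ (λ i j → completions i j L) t≡ s≡) ⟩
      F (s p pre) (s p post) ∎

    closing : sumOver (λ (pre , x , post) → sumOver (λ w → avoiding (juxtapose σ τ) (p ++ x ∷ w)) (continuations (pre ++ post) f L)) (splits e) ≡
      t p e * c + antidiag (λ i j → completions (t p e + i) j L) (s p e)
    closing = begin
      _ ≡⟨ sumOver-cong (splits e) (λ {(pre , x , post)} s∈ → one pre x post (splits-∈⁻ e s∈)) ⟩
      _ ≡⟨ sumOver-splits-failing (dangerous? p) c F e ⟩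
      t p e * c + antidiag F (s p e)
        ≡⟨ cong (t p e * c +_) (antidiag-side side (λ i j → completions (t p e + i) j L) (s p e)) ⟩
      _ ∎

  count-avoiders : ∀ L → ¬ Occurs σ [] → avoiders (juxtapose σ τ) L ≡ completions 0 0 L
  count-avoiders L = count-completions L initial

-- The patterns 1212 and 1221

crossing nesting : List ℕ
crossing = 0 ∷ 1 ∷ 0 ∷ 1 ∷ []
nesting  = 0 ∷ 1 ∷ 1 ∷ 0 ∷ []

two-letters-consistent : ∀ {a b z} → a ≢ b → All (λ c → c ≡ (a , 0) ⊎ c ≡ (b , 1)) z → Consistent z
two-letters-consistent {a} {b} a≢b all c∈ d∈ with All.lookup all c∈ | All.lookup all d∈
... | inj₁ refl | inj₁ refl = mk⇔ (λ _ → refl) (λ _ → refl)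
... | inj₂ refl | inj₂ refl = mk⇔ (λ _ → refl) (λ _ → refl)
... | inj₁ refl | inj₂ refl = mk⇔ (λ eq → contradiction eq a≢b) λ ()
... | inj₂ refl | inj₁ refl = mk⇔ (λ eq → contradiction (sym eq) a≢b) λ ()

occurs-crossing : Occurs crossing w ⇔ ∃₂ λ a b → a ≢ b × a ∷ b ∷ a ∷ b ∷ [] ⊆ w
occurs-crossing {w} = mk⇔ forth back
  where
  forth : Occurs crossing w → ∃₂ λ a b → a ≢ b × a ∷ b ∷ a ∷ b ∷ [] ⊆ w
  forth ((a , _) ∷ (b , _) ∷ (c , _) ∷ (d , _) ∷ [] , refl , s , con)
    with refl ← from (con (here refl) (there (there (here refl)))) refl
       | refl ← from (con (there (here refl)) (there (there (there (here refl))))) refl =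
    a , b , (λ eq → case (to (con (here refl) (there (here refl))) eq) of λ ()) , s
  back : (∃₂ λ a b → a ≢ b × a ∷ b ∷ a ∷ b ∷ [] ⊆ w) → Occurs crossing w
  back (a , b , a≢b , s) = (a , 0) ∷ (b , 1) ∷ (a , 0) ∷ (b , 1) ∷ [] , refl , s ,
    two-letters-consistent a≢b (inj₁ refl ∷ inj₂ refl ∷ inj₁ refl ∷ inj₂ refl ∷ [])

occurs-nesting : Occurs nesting w ⇔ ∃₂ λ a b → a ≢ b × a ∷ b ∷ b ∷ a ∷ [] ⊆ w
occurs-nesting {w} = mk⇔ forth back
  where
  forth : Occurs nesting w → ∃₂ λ a b → a ≢ b × a ∷ b ∷ b ∷ a ∷ [] ⊆ w
  forth ((a , _) ∷ (b , _) ∷ (c , _) ∷ (d , _) ∷ [] , refl , s , con)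
    with refl ← from (con (there (here refl)) (there (there (here refl)))) refl
       | refl ← from (con (here refl) (there (there (there (here refl))))) refl =
    a , b , (λ eq → case (to (con (here refl) (there (here refl))) eq) of λ ()) , s
  back : (∃₂ λ a b → a ≢ b × a ∷ b ∷ b ∷ a ∷ [] ⊆ w) → Occurs nesting w
  back (a , b , a≢b , s) = (a , 0) ∷ (b , 1) ∷ (b , 1) ∷ (a , 0) ∷ [] , refl , s ,
    two-letters-consistent a≢b (inj₁ refl ∷ inj₂ refl ∷ inj₂ refl ∷ inj₁ refl ∷ [])

crossing-snoc : ∀ {p y} → ¬ Occurs crossing p → Occurs crossing (p ++ [ y ]) →
  ∃ λ a → a ≢ y × a ∷ y ∷ a ∷ [] ⊆ p
crossing-snoc {p} ¬occ occ with to occurs-crossing occ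
... | a , b , a≢b , s with ⊆-snoc⁻ (a ∷ b ∷ a ∷ []) p s
...   | inj₁ s′          = contradiction (from occurs-crossing (a , b , a≢b , s′)) ¬occ
...   | inj₂ (refl , s′) = a , a≢b , s′

nesting-snoc : ∀ {p y} → ¬ Occurs nesting p → Occurs nesting (p ++ [ y ]) →
  ∃ λ b → b ≢ y × y ∷ b ∷ b ∷ [] ⊆ p
nesting-snoc {p} ¬occ occ with to occurs-nesting occ
... | a , b , a≢b , s with ⊆-snoc⁻ (a ∷ b ∷ b ∷ []) p s
...   | inj₁ s′          = contradiction (from occurs-nesting (a , b , a≢b , s′)) ¬occ
...   | inj₂ (refl , s′) = b , a≢b ∘ sym , s′

-- If `y` completes a crossing a y a y just after `z` was closed, the second a either lies in `p`,
-- so that `y` was already dangerous, or is the new `z`, so that `y` was opened after `z`.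
crossing-spreading : Spreading crossing
crossing-spreading = record
  { small       = s≤s z≤n ∷ s≤s (s≤s z≤n) ∷ s≤s z≤n ∷ s≤s (s≤s z≤n) ∷ []
  ; doubled     = doubled
  ; side        = later
  ; open-avoids = open-avoids
  ; open-safe   = λ f∉ ¬occ occ → let a , a≢f , s = crossing-snoc (open-avoids f∉ ¬occ) occ
                                  in f∉ (lookup (snoc-⊆ (a ∷ _ ∷ []) a≢f s) (there (here refl)))
  ; spread⁺     = λ z≢y s → from occurs-crossing (_ , _ , z≢y , ⊆-snoc (⊆-snoc s))
  ; spread⁻     = spread⁻
  }
  where
  open-avoids : ∀ {p f} → f ∉ p → ¬ Occurs crossing p → ¬ Occurs crossing (p ++ [ f ])
  open-avoids f∉ ¬occ occ = let _ , _ , s = crossing-snoc ¬occ occ in f∉ (lookup s (there (here refl)))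
  doubled : Doubled crossing
  doubled (here refl)                         = refl ∷ _ ∷ʳ refl ∷ _ ∷ʳ []
  doubled (there (here refl))                 = _ ∷ʳ refl ∷ _ ∷ʳ refl ∷ []
  doubled (there (there (here refl)))         = refl ∷ _ ∷ʳ refl ∷ _ ∷ʳ []
  doubled (there (there (there (here refl)))) = _ ∷ʳ refl ∷ _ ∷ʳ refl ∷ []
  spread⁻ : ∀ {p z y} → z ≢ y → ¬ Occurs crossing (p ++ [ z ]) → Occurs crossing ((p ++ [ z ]) ++ [ y ]) →
    Occurs crossing (p ++ [ y ]) ⊎ z ∷ y ∷ [] ⊆ p
  spread⁻ {p} {z} {y} z≢y ¬occ occ with crossing-snoc ¬occ occ
  ... | a , a≢y , s with ⊆-snoc⁻ (a ∷ y ∷ []) p s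
  ...   | inj₁ s′          = inj₁ (from occurs-crossing (a , y , a≢y , ⊆-snoc s′))
  ...   | inj₂ (refl , s′) = inj₂ s′

-- As for crossings, now with y b b y: if the second b is the new `z`, then `y` was opened before
-- `z`.
nesting-spreading : Spreading nesting
nesting-spreading = record
  { small       = s≤s z≤n ∷ s≤s (s≤s z≤n) ∷ s≤s (s≤s z≤n) ∷ s≤s z≤n ∷ []
  ; doubled     = doubled
  ; side        = earlier
  ; open-avoids = open-avoids
  ; open-safe   = λ f∉ ¬occ occ → let b , b≢f , s = nesting-snoc (open-avoids f∉ ¬occ) occ
                                  in f∉ (lookup (snoc-⊆ (_ ∷ b ∷ []) b≢f s) (here refl))
  ; spread⁺     = λ z≢y s → from occurs-nesting (_ , _ , z≢y ∘ sym , ⊆-snoc (⊆-snoc s))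
  ; spread⁻     = spread⁻
  }
  where
  open-avoids : ∀ {p f} → f ∉ p → ¬ Occurs nesting p → ¬ Occurs nesting (p ++ [ f ])
  open-avoids f∉ ¬occ occ = let _ , _ , s = nesting-snoc ¬occ occ in f∉ (lookup s (here refl))
  doubled : Doubled nesting
  doubled (here refl)                         = refl ∷ _ ∷ʳ _ ∷ʳ refl ∷ []
  doubled (there (here refl))                 = _ ∷ʳ refl ∷ refl ∷ _ ∷ʳ []
  doubled (there (there (here refl)))         = _ ∷ʳ refl ∷ refl ∷ _ ∷ʳ []
  doubled (there (there (there (here refl)))) = refl ∷ _ ∷ʳ _ ∷ʳ refl ∷ []
  spread⁻ : ∀ {p z y} → z ≢ y → ¬ Occurs nesting (p ++ [ z ]) → Occurs nesting ((p ++ [ z ]) ++ [ y ]) →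
    Occurs nesting (p ++ [ y ]) ⊎ y ∷ z ∷ [] ⊆ p
  spread⁻ {p} {z} {y} z≢y ¬occ occ with nesting-snoc ¬occ occ
  ... | b , b≢y , s with ⊆-snoc⁻ (y ∷ b ∷ []) p s
  ...   | inj₁ s′          = inj₁ (from occurs-nesting (y , b , b≢y ∘ sym , ⊆-snoc s′))
  ...   | inj₂ (refl , s′) = inj₂ s′

-- Words as vectors and as lists

letters : Vec (Fin n) m → List ℕ
letters v = toList (Vec.map toℕ v)

tabulate-lookup : ∀ (v : Vec A m) → tabulate (Vec.lookup v) ≡ toList v
tabulate-lookup []      = refl
tabulate-lookup (x ∷ v) = cong (x ∷_) (tabulate-lookup v)

lookup-letters : ∀ (v : Vec (Fin n) m) i → Vec.lookup (Vec.map toℕ v) i ≡ toℕ (Vec.lookup v i)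
lookup-letters v i = Vec.lookup-map i toℕ v

Increasing : (Fin n → Fin m) → Set
Increasing i = ∀ p q → p Fin.< q → i p Fin.< i q

positive : ∀ (j : Fin (suc m)) {k : Fin (suc m)} → k Fin.< j → ∃ λ j′ → j ≡ suc j′
positive (suc j) _ = j , refl

tabulate-⊆ : ∀ (w : Vec A m) (i : Fin n → Fin m) → Increasing i → tabulate (Vec.lookup w ∘ i) ⊆ toList w
tabulate-⊆ {n = zero}  w       i inc = minimum (toList w)
tabulate-⊆ {n = suc n} []      i inc with () ← i zero
tabulate-⊆ {n = suc n} (x ∷ w) i inc = first (i zero) refl
  where
  positives : ∀ p → ∃ λ j → i (suc p) ≡ suc j
  positives p = positive (i (suc p)) (inc zero (suc p) z<s)
  first : ∀ i₀ → i zero ≡ i₀ → tabulate (Vec.lookup (x ∷ w) ∘ i) ⊆ x ∷ toList w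
  first zero eq = cong (Vec.lookup (x ∷ w)) eq ∷
    subst (_⊆ toList w) (tabulate-cong λ p → sym (cong (Vec.lookup (x ∷ w)) (proj₂ (positives p))))
      (tabulate-⊆ w (proj₁ ∘ positives) λ p q p<q →
        s<s⁻¹ (subst₂ Fin._<_ (proj₂ (positives p)) (proj₂ (positives q)) (inc (suc p) (suc q) (s<s p<q))))
  first (suc i₀) eq = x ∷ʳ subst (_⊆ toList w)
    (tabulate-cong λ p → sym (cong (Vec.lookup (x ∷ w)) (proj₂ (shifted p))))
    (tabulate-⊆ w (proj₁ ∘ shifted) λ p q p<q →
      s<s⁻¹ (subst₂ Fin._<_ (proj₂ (shifted p)) (proj₂ (shifted q)) (inc p q p<q)))
    where
    shifted : ∀ p → ∃ λ j → i p ≡ suc j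
    shifted zero    = i₀ , eq
    shifted (suc p) = positives p

embedding : ∀ (w : Vec ℕ m) (v : Vec ℕ n) z → map proj₂ z ≡ toList v → map proj₁ z ⊆ toList w →
  ∃ λ i → Increasing (Vec.lookup i) × ∀ p → (Vec.lookup w (Vec.lookup i p) , Vec.lookup v p) ∈ z
embedding w       []      z             eq s = [] , (λ ()) , λ ()
embedding (x ∷ w) (b ∷ v) (c ∷ z)       eq (_ ∷ʳ s) with embedding w (b ∷ v) (c ∷ z) eq s
... | i , inc , ∈z = Vec.map suc i ,
  (λ p q p<q → subst₂ Fin._<_ (sym (Vec.lookup-map p suc i)) (sym (Vec.lookup-map q suc i)) (s<s (inc p q p<q))) ,
  λ p → subst (λ j → (Vec.lookup (x ∷ w) j , Vec.lookup (b ∷ v) p) ∈ c ∷ z) (sym (Vec.lookup-map p suc i)) (∈z p)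
embedding (x ∷ w) (b ∷ v) ((a , b′) ∷ z) eq (refl ∷ s) with ∷-injective eq
... | refl , eq′ with embedding w v z eq′ s
...   | i , inc , ∈z = zero ∷ Vec.map suc i , inc′ , ∈z′
  where
  inc′ : Increasing (Vec.lookup (zero ∷ Vec.map suc i))
  inc′ zero    (suc q) _   = subst (λ j → 0 < toℕ j) (sym (Vec.lookup-map q suc i)) z<s
  inc′ (suc p) (suc q) p<q =
    subst₂ Fin._<_ (sym (Vec.lookup-map p suc i)) (sym (Vec.lookup-map q suc i)) (s<s (inc p q (s<s⁻¹ p<q)))
  ∈z′ : ∀ p → (Vec.lookup (x ∷ w) (Vec.lookup (zero ∷ Vec.map suc i) p) , Vec.lookup (b ∷ v) p) ∈ (x , b) ∷ z
  ∈z′ zero    = here refl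
  ∈z′ (suc p) = there (subst (λ j → (Vec.lookup (x ∷ w) j , Vec.lookup v p) ∈ z) (sym (Vec.lookup-map p suc i)) (∈z p))

increasing-injective : ∀ {i : Fin n → Fin m} → Increasing i → ∀ {p q} → i p ≡ i q → p ≡ q
increasing-injective {i = i} inc {p} {q} eq with Fin.<-cmp p q
... | tri< p<q _ _ = contradiction eq (Fin.<⇒≢ (inc p q p<q))
... | tri≈ _ p≡q _ = p≡q
... | tri> _ _ q<p = contradiction (sym eq) (Fin.<⇒≢ (inc q p q<p))

-- Edges join distinct positions, while `Consistent` compares arbitrary entries. Both conditions
-- agree because an increasing choice of positions is injective.
contains⇔occurs : ∀ {k n} (σ : Word k) (w : Word n) → Contains σ w ⇔ Occurs (letters σ) (letters w)
contains⇔occurs {k} {n} σ w = mk⇔ forth back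
  where
  W : Vec ℕ (n * 2)
  W = Vec.map toℕ w
  V : Vec ℕ (k * 2)
  V = Vec.map toℕ σ
  forth : Contains σ w → Occurs (letters σ) (letters w)
  forth (i , inc , edges) = tabulate pair ,
    trans (map-tabulate pair proj₂) (tabulate-lookup V) ,
    subst (_⊆ toList W) (sym (map-tabulate pair proj₁)) (tabulate-⊆ W (Vec.lookup i) inc) ,
    λ c∈ d∈ → relate (∈-tabulate⁻ c∈) (∈-tabulate⁻ d∈)
    where
    pair : Fin (k * 2) → ℕ × ℕ
    pair p = Vec.lookup W (Vec.lookup i p) , Vec.lookup V p
    relate : ∀ {c d} → (∃ λ p → c ≡ pair p) → (∃ λ q → d ≡ pair q) → proj₁ c ≡ proj₁ d ⇔ proj₂ c ≡ proj₂ d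
    relate (p , refl) (q , refl)
      rewrite lookup-letters w (Vec.lookup i p) | lookup-letters w (Vec.lookup i q) | lookup-letters σ p | lookup-letters σ q
      with p Fin.≟ q
    ... | yes refl = mk⇔ (λ _ → refl) (λ _ → refl)
    ... | no  p≢q  = mk⇔
      (λ eq → cong toℕ (proj₂ (to (edges p q) (p≢q ∘ increasing-injective inc , Fin.toℕ-injective eq))))
      (λ eq → cong toℕ (proj₂ (from (edges p q) (p≢q , Fin.toℕ-injective eq))))
  back : Occurs (letters σ) (letters w) → Contains σ w
  back (z , eq , s , con) with embedding W V z eq s
  ... | i , inc , ∈z = i , inc , λ p q → mk⇔
    (λ (i≢ , eq) → (λ { refl → i≢ refl }) , Fin.toℕ-injective
      (subst₂ _≡_ (lookup-letters σ p) (lookup-letters σ q) (to (con (∈z p) (∈z q))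
        (subst₂ _≡_ (sym (lookup-letters w (Vec.lookup i p))) (sym (lookup-letters w (Vec.lookup i q))) (cong toℕ eq)))))
    (λ (p≢q , eq) → p≢q ∘ increasing-injective inc , Fin.toℕ-injective
      (subst₂ _≡_ (lookup-letters w (Vec.lookup i p)) (lookup-letters w (Vec.lookup i q)) (from (con (∈z p) (∈z q))
        (subst₂ _≡_ (sym (lookup-letters σ p)) (sym (lookup-letters σ q)) (cong toℕ eq)))))

-- Letter counts and restricted growth

occurrences : ℕ → List ℕ → ℕ
occurrences x = satisfying (x ≟_)

occurrences-≡ : ∀ x w → occurrences x (x ∷ w) ≡ suc (occurrences x w)
occurrences-≡ x w rewrite dec-true (x ≟ x) refl = refl

occurrences-≢ : ∀ {x y} w → x ≢ y → occurrences x (y ∷ w) ≡ occurrences x w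
occurrences-≢ {x} {y} w x≢y rewrite dec-false (x ≟ y) x≢y = refl

occurrences-∉ : ∀ {x} w → x ∉ w → occurrences x w ≡ 0
occurrences-∉ []      x∉ = refl
occurrences-∉ (y ∷ w) x∉ = trans (occurrences-≢ w (x∉ ∘ here)) (occurrences-∉ w (x∉ ∘ there))

occurrences-∈ : ∀ {x} w → occurrences x w ≢ 0 → x ∈ w
occurrences-∈ []          ≢0 = contradiction refl ≢0
occurrences-∈ {x} (y ∷ w) ≢0 with x ≟ y
... | yes refl = here refl
... | no  x≢y  = there (occurrences-∈ w (≢0 ∘ trans (occurrences-≢ w x≢y)))

occurrences-⊆ : ∀ {x} w → 2 ≤ occurrences x w → x ∷ x ∷ [] ⊆ w
occurrences-⊆ {x} (y ∷ w) 2≤ with x ≟ y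
... | yes refl = refl ∷ from∈ (occurrences-∈ w (≢-sym (<⇒≢ (s≤s⁻¹ (subst (2 ≤_) (occurrences-≡ x w) 2≤)))))
... | no  x≢y  = y ∷ʳ occurrences-⊆ w (subst (2 ≤_) (occurrences-≢ w x≢y) 2≤)

occurrences-remove : ∀ x pre y post →
  occurrences x (pre ++ y ∷ post) ≡ occurrences x (y ∷ pre ++ post)
occurrences-remove x pre y post = begin
  occurrences x (pre ++ y ∷ post)                  ≡⟨ sumOver-++ _ pre (y ∷ post) ⟩
  occurrences x pre + (i + occurrences x post)     ≡⟨ r (occurrences x pre) i (occurrences x post) ⟩
  i + (occurrences x pre + occurrences x post)     ≡⟨ cong (i +_) (sumOver-++ _ pre post) ⟨
  i + occurrences x (pre ++ post)                  ∎
  where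
  i : ℕ
  i = indicator (does (x ≟ y))
  r : ∀ a b c → a + (b + c) ≡ b + (a + c)
  r = solve-∀

-- Restricted growth words, the usual encoding of set partitions, begun when the letters below `f`
-- have been used. They mediate between the condition on left vertices and reading letter by letter.
data RestrictedGrowth : ℕ → List ℕ → Set where
  []  : RestrictedGrowth f []
  new : RestrictedGrowth (suc f) w → RestrictedGrowth f (f ∷ w)
  old : ∀ {y} → y < f → RestrictedGrowth f w → RestrictedGrowth f (y ∷ w)

-- The total number of letters is not known here, so a letter from `f` on may be absent or appear
-- twice. After `f` is opened it is due once more, just like the letters of `e`.
continuation⁺ : RestrictedGrowth f w → All (_< f) e →
  (∀ x → x < f → occurrences x w ≡ occurrences x e) →
  (∀ x → f ≤ x → occurrences x w ≡ 0 ⊎ occurrences x w ≡ 2) → Continuation e f w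
continuation⁺ {e = []} [] _ _ _ = ends
continuation⁺ {e = y ∷ e} [] (y<f ∷ _) lo _ = contradiction (trans (lo y y<f) (occurrences-≡ y e)) λ ()
continuation⁺ {f} {_ ∷ w} {e} (new g) e<f lo hi =
  opens (continuation⁺ g (≤-refl ∷ All.map m<n⇒m<1+n e<f) lo′
    λ x f<x → subst (λ k → k ≡ 0 ⊎ k ≡ 2) (occurrences-≢ w (≢-sym (<⇒≢ f<x))) (hi x (<⇒≤ f<x)))
  where
  f∉e : f ∉ e
  f∉e f∈ = <-irrefl refl (All.lookup e<f f∈)
  lo′ : ∀ x → x < suc f → occurrences x w ≡ occurrences x (f ∷ e)
  lo′ x x<1+f with m<1+n⇒m<n∨m≡n x<1+f
  ... | inj₁ x<f = begin
    occurrences x w       ≡⟨ occurrences-≢ w (<⇒≢ x<f) ⟨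
    occurrences x (f ∷ w) ≡⟨ lo x x<f ⟩
    occurrences x e       ≡⟨ occurrences-≢ e (<⇒≢ x<f) ⟨
    occurrences x (f ∷ e) ∎
  ... | inj₂ refl with hi f ≤-refl
  ...   | inj₁ eq = contradiction (trans (sym (occurrences-≡ f w)) eq) λ ()
  ...   | inj₂ eq = begin
    occurrences f w       ≡⟨ suc-injective (trans (sym (occurrences-≡ f w)) eq) ⟩
    1                     ≡⟨ cong suc (occurrences-∉ e f∉e) ⟨
    suc (occurrences f e) ≡⟨ occurrences-≡ f e ⟨
    occurrences f (f ∷ e) ∎
continuation⁺ {f} {y ∷ w} {e} (old y<f g) e<f lo hi
  with ∈-∃++ (occurrences-∈ {y} e λ eq → case trans (sym (occurrences-≡ y w)) (trans (lo y y<f) eq) of λ ())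
... | pre , post , refl = closes pre y post refl
  (continuation⁺ g (All-resp-⊆ (remove-⊆ pre y post) e<f)
    (λ x x<f → +-cancelˡ-≡ (indicator (does (x ≟ y))) _ _ (trans (lo x x<f) (occurrences-remove x pre y post)))
    λ x f≤x → subst (λ k → k ≡ 0 ⊎ k ≡ 2) (occurrences-≢ w (≢-sym (<⇒≢ (<-≤-trans y<f f≤x)))) (hi x f≤x))

-- `size` is the number of edges of the whole matching. The prefix has 2f letters minus one for each
-- open edge; `lengths` says, without subtraction, that prefix and `w` have `size * 2` letters
-- together.
record Completed (e : List ℕ) (f : ℕ) (w : List ℕ) : Set where
  field
    size    : ℕ
    f≤size  : f ≤ size
    lengths : length w + f * 2 ≡ length e + size * 2
    bounded : All (_< size) w
    growth  : RestrictedGrowth f w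
    pending  : ∀ x → x < f → occurrences x w ≡ occurrences x e
    twice   : ∀ x → f ≤ x → x < size → occurrences x w ≡ 2

continuation⁻ : Continuation e f w → All (_< f) e → Completed e f w
continuation⁻ {f = f} ends [] = record
  { size = f ; f≤size = ≤-refl ; lengths = refl ; bounded = [] ; growth = []
  ; pending = λ _ _ → refl ; twice = λ x f≤x x<f → contradiction x<f (≤⇒≯ f≤x) }
continuation⁻ {e} {f} {_ ∷ w} (opens c) e<f = record
  { size    = size
  ; f≤size  = <⇒≤ f≤size
  ; lengths = suc-injective (trans (r (length w) (f * 2)) lengths)
  ; bounded = f≤size ∷ bounded
  ; growth  = new growth
  ; pending  = λ x x<f → begin
      occurrences x (f ∷ w) ≡⟨ occurrences-≢ w (<⇒≢ x<f) ⟩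
      occurrences x w       ≡⟨ pending x (m<n⇒m<1+n x<f) ⟩
      occurrences x (f ∷ e) ≡⟨ occurrences-≢ e (<⇒≢ x<f) ⟩
      occurrences x e       ∎
  ; twice   = twice′
  }
  where
  open Completed (continuation⁻ c (≤-refl ∷ All.map m<n⇒m<1+n e<f))
  r : ∀ a b → 1 + (1 + a + b) ≡ a + (2 + b)
  r = solve-∀
  twice′ : ∀ x → f ≤ x → x < size → occurrences x (f ∷ w) ≡ 2
  twice′ x f≤x x<size with m≤n⇒m<n∨m≡n f≤x
  ... | inj₁ f<x  = trans (occurrences-≢ w (≢-sym (<⇒≢ f<x))) (twice x f<x x<size)
  ... | inj₂ refl = begin
    occurrences f (f ∷ w)       ≡⟨ occurrences-≡ f w ⟩
    suc (occurrences f w)       ≡⟨ cong suc (pending f ≤-refl) ⟩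
    suc (occurrences f (f ∷ e)) ≡⟨ cong suc (occurrences-≡ f e) ⟩
    2 + occurrences f e         ≡⟨ cong (2 +_) (occurrences-∉ e λ f∈ → <-irrefl refl (All.lookup e<f f∈)) ⟩
    2                           ∎
continuation⁻ {e} {f} {x ∷ w} (closes pre x post refl c) e<f = record
  { size    = size
  ; f≤size  = f≤size
  ; lengths = trans (cong suc lengths) (cong (_+ size * 2)
      (trans (cong suc (length-++ pre)) (sym (trans (length-++ pre) (+-suc (length pre) (length post))))))
  ; bounded = <-≤-trans x<f f≤size ∷ bounded
  ; growth  = old x<f growth
  ; pending  = λ y y<f → trans (cong (indicator (does (y ≟ x)) +_) (pending y y<f)) (sym (occurrences-remove y pre x post))
  ; twice   = λ y f≤y y<size → trans (occurrences-≢ w (≢-sym (<⇒≢ (<-≤-trans x<f f≤y)))) (twice y f≤y y<size)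
  }
  where
  open Completed (continuation⁻ c (All-resp-⊆ (remove-⊆ pre x post) e<f))
  x<f : x < f
  x<f = All.lookup e<f (∈-insert pre)

count-occurrences : ∀ (a : Fin n) (v : Vec (Fin n) m) → Vec.count (a Fin.≟_) v ≡ occurrences (toℕ a) (letters v)
count-occurrences a []      = refl
count-occurrences a (b ∷ v)
  with does (a Fin.≟ b) | does (toℕ a ≟ toℕ b) | does-⇔ (mk⇔ (cong toℕ) Fin.toℕ-injective) (a Fin.≟ b) (toℕ a ≟ toℕ b)
... | true  | true  | _ = cong suc (count-occurrences a v)
... | false | false | _ = count-occurrences a v

letters-< : ∀ (v : Vec (Fin n) m) → All (_< n) (letters v)
letters-< []      = []
letters-< (a ∷ v) = Fin.toℕ<n a ∷ letters-< v

Preceded : ℕ → Vec (Fin n) m → Set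
Preceded f v = ∀ j x → f ≤ x → x < toℕ (Vec.lookup v j) → ∃ λ i → i Fin.< j × toℕ (Vec.lookup v i) ≡ x

growth⇒preceded : ∀ (v : Vec (Fin n) m) → RestrictedGrowth f (letters v) → Preceded f v
growth⇒preceded (a ∷ v) (new g) zero    x f≤x x<f = contradiction x<f (≤⇒≯ f≤x)
growth⇒preceded (a ∷ v) (new g) (suc j) x f≤x x<j with m≤n⇒m<n∨m≡n f≤x
... | inj₂ refl = zero , z<s , refl
... | inj₁ f<x  = let i , i<j , eq = growth⇒preceded v g j x f<x x<j in suc i , s<s i<j , eq
growth⇒preceded (a ∷ v) (old a<f g) zero    x f≤x x<a = contradiction (<-trans x<a a<f) (≤⇒≯ f≤x)
growth⇒preceded (a ∷ v) (old a<f g) (suc j) x f≤x x<j =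
  let i , i<j , eq = growth⇒preceded v g j x f≤x x<j in suc i , s<s i<j , eq

preceded⇒growth : ∀ f (v : Vec (Fin n) m) → Preceded f v → RestrictedGrowth f (letters v)
preceded⇒growth f []      pre = []
preceded⇒growth f (a ∷ v) pre with <-cmp (toℕ a) f
... | tri> _ _ f<a with () ← proj₁ (proj₂ (pre zero f ≤-refl f<a))
... | tri< a<f _ _ = old a<f (preceded⇒growth f v λ j x f≤x x<j → case pre (suc j) x f≤x x<j of λ where
  (zero  , _   , eq) → contradiction (subst (_< f) eq a<f) (≤⇒≯ f≤x)
  (suc i , i<j , eq) → i , s<s⁻¹ i<j , eq)
... | tri≈ _ refl _ = new (preceded⇒growth (suc f) v λ j x f<x x<j → case pre (suc j) x (<⇒≤ f<x) x<j of λ where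
  (zero  , _   , eq) → contradiction eq (<⇒≢ f<x)
  (suc i , i<j , eq) → i , s<s⁻¹ i<j , eq)

first-occurrence : ∀ (v : Vec (Fin n) m) a → a ∈ toList v →
  ∃ λ i → Vec.lookup v i ≡ a × ∀ j → Vec.lookup v j ≡ a → i Fin.≤ j
first-occurrence (b ∷ v) a a∈ with b Fin.≟ a
... | yes refl = zero , refl , λ _ _ → z≤n
... | no  b≢a with a∈
...   | here eq  = contradiction (sym eq) b≢a
...   | there a∈′ = let i , eq , least = first-occurrence v a a∈′ in suc i , eq , λ where
  zero    eq′ → contradiction eq′ b≢a
  (suc j) eq′ → s≤s (least j eq′)

∈-letters : ∀ (v : Vec (Fin n) m) {a : Fin n} → toℕ a ∈ letters v → a ∈ toList v
∈-letters (b ∷ v) (here eq)  = here (Fin.toℕ-injective eq)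
∈-letters (b ∷ v) (there a∈) = there (∈-letters v a∈)

-- First occurrences are left vertices. If the smaller letter `x` first appeared after the first
-- occurrence of the letter at `j`, `increasing` would put the two letters in the wrong order.
matching⇒preceded : ∀ (v : Word n) → IsMatching v → Preceded 0 v
matching⇒preceded {n} v (isMatching twice increasing) j x _ x<j = i , i<j , trans (cong toℕ vi≡a) (Fin.toℕ-fromℕ< x<n)
  where
  x<n : x < n
  x<n = <-trans x<j (Fin.toℕ<n (Vec.lookup v j))
  a : Fin n
  a = fromℕ< x<n
  first : ∀ b → ∃ λ i → Vec.lookup v i ≡ b × LeftVertex v i
  first b =
    let i , vi≡b , least = first-occurrence v b (∈-letters v (occurrences-∈ (letters v)
          λ eq → case trans (sym (twice b)) (trans (count-occurrences b v) eq) of λ ()))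
    in i , vi≡b , λ k (i≢k , eq) → Fin.≤∧≢⇒< (least k (trans (sym eq) vi≡b)) i≢k
  i i′ : Fin (n * 2)
  i  = proj₁ (first a)
  i′ = proj₁ (first (Vec.lookup v j))
  vi≡a : Vec.lookup v i ≡ a
  vi≡a = proj₁ (proj₂ (first a))
  vi′≡vj : Vec.lookup v i′ ≡ Vec.lookup v j
  vi′≡vj = proj₁ (proj₂ (first (Vec.lookup v j)))
  a<vj : a Fin.< Vec.lookup v j
  a<vj = subst (_< toℕ (Vec.lookup v j)) (sym (Fin.toℕ-fromℕ< x<n)) x<j
  i′≤j : i′ Fin.≤ j
  i′≤j with i′ Fin.≟ j
  ... | yes eq = Fin.≤-reflexive eq
  ... | no  ≢j = <⇒≤ (proj₂ (proj₂ (first (Vec.lookup v j))) j (≢j , vi′≡vj))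
  i<i′ : i Fin.< i′
  i<i′ with Fin.<-cmp i i′
  ... | tri< lt _ _ = lt
  ... | tri≈ _ eq _ = contradiction (trans (sym vi≡a) (trans (cong (Vec.lookup v) eq) vi′≡vj)) (Fin.<⇒≢ a<vj)
  ... | tri> _ _ gt = contradiction
    (subst₂ Fin._<_ vi′≡vj vi≡a (increasing i′ i (proj₂ (proj₂ (first _))) (proj₂ (proj₂ (first a))) gt)) (Fin.<-asym a<vj)
  i<j : i Fin.< j
  i<j = <-≤-trans i<i′ i′≤j

-- A smaller letter at `j` would have appeared before `i` already, so `j` would not be a left
-- vertex.
preceded⇒increasing : ∀ (v : Word n) → Preceded 0 v →
  ∀ i j → LeftVertex v i → LeftVertex v j → i Fin.< j → Vec.lookup v i Fin.< Vec.lookup v j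
preceded⇒increasing v pre i j left-i left-j i<j with Fin.<-cmp (Vec.lookup v i) (Vec.lookup v j)
... | tri< lt _ _ = lt
... | tri≈ _ eq _ = contradiction (left-j i (≢-sym (Fin.<⇒≢ i<j) , sym eq)) (Fin.<-asym i<j)
... | tri> _ _ gt =
  let k , k<i , eq = pre i (toℕ (Vec.lookup v j)) z≤n gt
      k<j = Fin.<-trans k<i i<j
  in contradiction (left-j k (≢-sym (Fin.<⇒≢ k<j) , sym (Fin.toℕ-injective eq))) (Fin.<-asym k<j)

matching⇒continuation : ∀ (v : Word n) → IsMatching v → Continuation [] 0 (letters v)
matching⇒continuation {n} v mat = continuation⁺ (preceded⇒growth 0 v (matching⇒preceded v mat)) [] (λ _ ()) λ x _ → cases x
  where
  cases : ∀ x → occurrences x (letters v) ≡ 0 ⊎ occurrences x (letters v) ≡ 2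
  cases x with x <? n
  ... | yes x<n = inj₂ (subst (λ y → occurrences y (letters v) ≡ 2) (Fin.toℕ-fromℕ< x<n)
    (trans (sym (count-occurrences (fromℕ< x<n) v)) (IsMatching.twice mat (fromℕ< x<n))))
  ... | no  x≮n = inj₁ (occurrences-∉ (letters v) λ x∈ → x≮n (All.lookup (letters-< v) x∈))

from-letters : ∀ m (w : List ℕ) → length w ≡ m → All (_< n) w → ∃ λ (v : Vec (Fin n) m) → letters v ≡ w
from-letters zero    []      eq []          = [] , refl
from-letters (suc m) (x ∷ w) eq (x<n ∷ w<n) =
  let v , v≡w = from-letters m w (suc-injective eq) w<n
  in fromℕ< x<n ∷ v , cong₂ _∷_ (Fin.toℕ-fromℕ< x<n) v≡w

continuation⇒matching : Continuation [] 0 w → length w ≡ n * 2 → ∃ λ (v : Word n) → letters v ≡ w × IsMatching v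
continuation⇒matching {w} {n} c len = v , v≡w , isMatching
  (λ a → trans (count-occurrences a v)
    (trans (cong (occurrences (toℕ a)) v≡w) (twice (toℕ a) z≤n (subst (toℕ a <_) (sym size≡n) (Fin.toℕ<n a)))))
  (preceded⇒increasing v (growth⇒preceded v (subst (RestrictedGrowth 0) (sym v≡w) growth)))
  where
  open Completed (continuation⁻ c [])
  size≡n : size ≡ n
  size≡n = *-cancelʳ-≡ size n 2 (trans (sym lengths) (trans (+-identityʳ (length w)) len))
  word : ∃ λ (v : Word n) → letters v ≡ w
  word = from-letters (n * 2) w len (subst (λ k → All (_< k) w) size≡n bounded)
  v : Word n
  v = proj₁ word
  v≡w : letters v ≡ w
  v≡w = proj₂ word

-- Comparison of the two enumerations of matchings

letters-injective : ∀ {u v : Vec (Fin n) m} → letters u ≡ letters v → u ≡ v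
letters-injective {u = []}    {[]}    eq = refl
letters-injective {u = a ∷ u} {b ∷ v} eq =
  cong₂ _∷_ (Fin.toℕ-injective (proj₁ (∷-injective eq))) (letters-injective (∷-injectiveʳ eq))

splits-letters : ∀ (xs : List A) → map (proj₁ ∘ proj₂) (splits xs) ≡ xs
splits-letters []       = refl
splits-letters (x ∷ xs) = cong (x ∷_) (trans (sym (map-∘ (splits xs))) (splits-letters xs))

-- The branches differ in their first letter: the open letters are distinct and all below `f`.
continuations-unique : ∀ e f L → AllPairs _≢_ e → All (_< f) e → Unique (continuations e f L)
continuations-unique []      f zero    u e<f = [] ∷ []
continuations-unique (_ ∷ _) f zero    u e<f = []
continuations-unique e       f (suc L) u e<f = Unique.++⁺
  (Unique.map⁺ ∷-injectiveʳ (continuations-unique (f ∷ e) (suc f) L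
    (All.map (λ y<f → ≢-sym (<⇒≢ y<f)) e<f ∷ u) (≤-refl ∷ All.map m<n⇒m<1+n e<f)))
  (Unique.concat⁺
    (All.map⁺ (All.tabulate λ {(pre , x , post)} s∈ → unique-close pre x post (splits-∈⁻ e s∈)))
    (AllPairs.map⁺ (AllPairs.map (λ {s} {s′} → disjoint {s} {s′}) (AllPairs.map⁻ (subst (AllPairs _≢_) (sym (splits-letters e)) u)))))
  (λ (w∈ˡ , w∈ʳ) → separate (∈-map⁻ (f ∷_) w∈ˡ) (find (∈-concatMap⁻ _ {xs = splits e} w∈ʳ)))
  where
  branch : List ℕ × ℕ × List ℕ → List (List ℕ)
  branch (pre , x , post) = map (x ∷_) (continuations (pre ++ post) f L)
  unique-close : ∀ pre x post → e ≡ pre ++ x ∷ post → Unique (branch (pre , x , post))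
  unique-close pre x post refl = Unique.map⁺ ∷-injectiveʳ (continuations-unique (pre ++ post) f L
    (AllPairs-resp-⊆ (remove-⊆ pre x post) u) (All-resp-⊆ (remove-⊆ pre x post) e<f))
  disjoint : ∀ {s s′} → proj₁ (proj₂ s) ≢ proj₁ (proj₂ s′) → ∀ {w} → ¬ (w ∈ branch s × w ∈ branch s′)
  disjoint x≢x′ (w∈ , w∈′) with _ , _ , refl ← ∈-map⁻ _ w∈ | _ , _ , eq ← ∈-map⁻ _ w∈′ = x≢x′ (proj₁ (∷-injective eq))
  separate : ∀ {w} → (∃ λ w′ → w′ ∈ continuations (f ∷ e) (suc f) L × w ≡ f ∷ w′) →
    ¬ (∃ λ s → s ∈ splits e × w ∈ branch s)
  separate (_ , _ , refl) ((pre , x , post) , s∈ , w∈) with _ , _ , eq ← ∈-map⁻ _ w∈ =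
    <⇒≢ (All.lookup e<f (subst (x ∈_) (sym (splits-∈⁻ e s∈)) (∈-insert pre))) (sym (proj₁ (∷-injective eq)))

length-filter : ∀ {P : A → Set} (P? : ∀ x → Dec (P x)) xs → length (filter (¬? ∘ P?) xs) ≡ failing P? xs
length-filter P? []       = refl
length-filter P? (x ∷ xs) with P? x
... | yes _ = length-filter P? xs
... | no  _ = cong suc (length-filter P? xs)

unique-length : ∀ {xs ys : List A} → Unique xs → Unique ys → (∀ {x} → x ∈ xs ⇔ x ∈ ys) → length xs ≡ length ys
unique-length u u′ eq = ↭-length (∼bag⇒↭ (unique∧set⇒bag u u′ eq))

-- One list filters all words, the other is built letter by letter. Neither repeats a word and
-- `letters` is injective, so having the same members suffices.
∣𝓜∣≡avoiders : ∀ n {k} (σ : Word k) → ∣𝓜∣ n σ ≡ avoiders (letters σ) (n * 2)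
∣𝓜∣≡avoiders n σ = begin
  length (𝓜 n σ)               ≡⟨ length-map letters (𝓜 n σ) ⟨
  length (map letters (𝓜 n σ)) ≡⟨ unique-length (Unique.map⁺ letters-injective (𝓜-unique n σ))
                                     (Unique.filter⁺ (¬? ∘ O?) (continuations-unique [] 0 (n * 2) [] [])) (mk⇔ forth back) ⟩
  length (filter (¬? ∘ O?) (continuations [] 0 (n * 2))) ≡⟨ length-filter O? (continuations [] 0 (n * 2)) ⟩
  avoiders (letters σ) (n * 2) ∎
  where
  O? : ∀ w → Dec (Occurs (letters σ) w)
  O? = occurs? (letters σ)
  forth : ∀ {w} → w ∈ map letters (𝓜 n σ) → w ∈ filter (¬? ∘ O?) (continuations [] 0 (n * 2))
  forth w∈ with v , v∈ , refl ← ∈-map⁻ letters w∈ =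
    let mat , avo = to (∈-𝓜 σ v) v∈
    in ∈-filter⁺ (¬? ∘ O?)
         (subst (λ L → letters v ∈ continuations [] 0 L) (Vec.length-toList (Vec.map toℕ v))
           (continuations-∈⁺ (matching⇒continuation v mat)))
         (avo ∘ from (contains⇔occurs σ v))
  back : ∀ {w} → w ∈ filter (¬? ∘ O?) (continuations [] 0 (n * 2)) → w ∈ map letters (𝓜 n σ)
  back w∈ with w∈′ , avo ← ∈-filter⁻ (¬? ∘ O?) {xs = continuations [] 0 (n * 2)} w∈
          with c , len ← continuations-∈⁻ [] 0 (n * 2) w∈′
          with v , refl , mat ← continuation⇒matching {n = n} c len =
    ∈-map⁺ letters (from (∈-𝓜 σ v) (mat , avo ∘ to (contains⇔occurs σ v)))

letters-juxtapose : ∀ {k} (σ : Word 2) (τ : Word k) → letters (σ ⟨ τ +2⟩) ≡ juxtapose (letters σ) (letters τ)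
letters-juxtapose {k} σ τ = begin
  toList (Vec.map toℕ (Vec.map (Fin._↑ˡ k) σ Vec.++ Vec.map (2 Fin.↑ʳ_) τ))
    ≡⟨ cong toList (Vec.map-++ toℕ (Vec.map (Fin._↑ˡ k) σ) (Vec.map (2 Fin.↑ʳ_) τ)) ⟩
  toList (Vec.map toℕ (Vec.map (Fin._↑ˡ k) σ) Vec.++ Vec.map toℕ (Vec.map (2 Fin.↑ʳ_) τ))
    ≡⟨ Vec.toList-++ (Vec.map toℕ (Vec.map (Fin._↑ˡ k) σ)) _ ⟩
  letters (Vec.map (Fin._↑ˡ k) σ) ++ letters (Vec.map (2 Fin.↑ʳ_) τ)
    ≡⟨ cong₂ _++_ (cong toList (trans (sym (Vec.map-∘ toℕ (Fin._↑ˡ k) σ)) (Vec.map-cong (λ a → Fin.toℕ-↑ˡ a k) σ)))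
         (trans (cong toList (trans (sym (Vec.map-∘ toℕ (2 Fin.↑ʳ_) τ)) (trans (Vec.map-cong (Fin.toℕ-↑ʳ 2) τ) (Vec.map-∘ (2 +_) toℕ τ))))
                (Vec.toList-map (2 +_) (Vec.map toℕ τ))) ⟩
  juxtapose (letters σ) (letters τ) ∎

matching-doubled : ∀ (v : Word n) → IsMatching v → Doubled (letters v)
matching-doubled {n} v mat {x} x∈ = occurrences-⊆ (letters v) (≤-reflexive (sym
  (subst (λ y → occurrences y (letters v) ≡ 2) (Fin.toℕ-fromℕ< x<n)
    (trans (sym (count-occurrences (fromℕ< x<n) v)) (IsMatching.twice mat (fromℕ< x<n))))))
  where
  x<n : x < n
  x<n = All.lookup (letters-< v) x∈

spreading : ∀ {σ} → σ ≡ w1212 ⊎ σ ≡ w1221 → Spreading (letters σ)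
spreading (inj₁ refl) = crossing-spreading
spreading (inj₂ refl) = nesting-spreading

empty-avoids : ∀ {a v} → ¬ Occurs (a ∷ v) []
empty-avoids ([] , () , _)
empty-avoids (_ ∷ _ , _ , () , _)

theorem1 : (σ : Word 2) → (σ ≡ w1212 ⊎ σ ≡ w1221) →
    (m : ℕ) (τ : Word m) → IsMatching τ →
    (n : ℕ) → 2 ≤ n →
    ∣𝓜∣ n (σ ⟨ τ +2⟩) ≡ catalan n +
    ∑ 2 n (λ ℓ → ∑ 0 (n ∸ ℓ) (λ k →
    ((2 * ℓ ∸ 1) C (ℓ ∸ 2)) * ((2 * ℓ ∸ 1 + k) C k) * ((2 * (n ∸ ℓ) ∸ k) C k) * (k !) * ∣𝓜∣ (n ∸ ℓ ∸ k) τ))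
-- The split exposes a first letter of `σ`, which is what `empty-avoids` asks for.
theorem1 σ@(_ ∷ _) σ≡ m τ mat n 2≤n = begin
  ∣𝓜∣ n (σ ⟨ τ +2⟩)
    ≡⟨ ∣𝓜∣≡avoiders n (σ ⟨ τ +2⟩) ⟩
  avoiders (letters (σ ⟨ τ +2⟩)) (n * 2)
    ≡⟨ cong (λ v → avoiders v (n * 2)) (letters-juxtapose σ τ) ⟩
  avoiders (juxtapose (letters σ) (letters τ)) (n * 2)
    ≡⟨ Avoiders.count-avoiders (letters σ) (letters τ) (spreading σ≡) (matching-doubled τ mat) (n * 2) empty-avoids ⟩
  Counting.completions (suffixes (avoiders (letters τ))) 0 0 (n * 2)
    ≡⟨ completions-formula (avoiders (letters τ)) (λ j → ∣𝓜∣ j τ) (λ j → sym (∣𝓜∣≡avoiders j τ)) n 2≤n ⟩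
  _ ∎
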